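{- For every integer $n\ge 1$, \[ \mathsf{HDE}(P_4,P_{4n+2}) = \frac{4n+1}{4n^2+3n+1}. \]
   Context: Graphs are finite directed graphs; homomorphisms $\varphi:F\to G$ are maps $V_F\to V_G$ sending edges to edges; $\hom(F,G)$ is their number. For $F\to G$ (i.e. $\hom(F,G)\ge1$), $\mathsf{HDE}(F,G)=\sup\{c\in\mathbb R:\hom(F,T)\ge\hom(G,T)^c\text{ for all graphs }T\}$. $P_m$ is the undirected path with $m$ vertices and $m-1$ edges, viewed as a directed graph with each undirected edge present in both directions. -}

module Defs where

open import Data.Bool using (Bool; T; _∨_)
open import Data.Bool.Properties using (T?)
open import Data.Empty using (⊥)
open import Data.Fin using (Fin; toℕ; finToFun)
open import Data.Fin.Properties using (all?)
open import Data.Integer using (+_; -[1+_])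
open import Data.List using (length; filter; map; allFin)
open import Data.Nat using (ℕ; zero; suc; _≡ᵇ_)
import Data.Nat as ℕ
open import Data.Product using (∃; _×_; _,_)
open import Data.Rational using (ℚ; 0ℚ; 1ℚ; _<_; _+_; -_; ↥_; ↧ₙ_)
open import Data.Rational.Properties
  using (<-cmp; <-dense; <-trans; <-asym; +-monoʳ-<; +-identityʳ; positive⁻¹; negative⁻¹)
open import Data.Sum using (_⊎_; inj₁; inj₂)
open import Relation.Binary.Definitions using (tri<; tri≈; tri>)
open import Relation.Binary.PropositionalEquality using (_≡_; refl; subst)
open import Relation.Nullary using (Dec)
open import Relation.Nullary.Decidable using (_→-dec_)

-- Finite directed graphs: an arbitrary edge set E ⊆ V × V (loops allowed) on
-- the vertex set Fin ∣V∣.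
record Graph : Set where
  field
    ∣V∣  : ℕ
    edge : Fin ∣V∣ → Fin ∣V∣ → Bool

open Graph public

IsHom : (F G : Graph) → (Fin (∣V∣ F) → Fin (∣V∣ G)) → Set
IsHom F G φ = ∀ u v → T (edge F u v) → T (edge G (φ u) (φ v))

isHom? : (F G : Graph) → ∀ φ → Dec (IsHom F G φ)
isHom? F G φ =
  all? λ u → all? λ v → T? (edge F u v) →-dec T? (edge G (φ u) (φ v))

-- finToFun lists every map V_F → V_G exactly once.
hom : Graph → Graph → ℕ
hom F G =
  length (filter (isHom? F G) (map finToFun (allFin (∣V∣ G ℕ.^ ∣V∣ F))))

P : ℕ → Graph
P m = record
  { ∣V∣  = m
  ; edge = λ i j → (suc (toℕ i) ≡ᵇ toℕ j) ∨ (suc (toℕ j) ≡ᵇ toℕ i)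
  }

-- Dedekind reals.
record ℝ : Set₁ where
  field
    L U         : ℚ → Set
    L-inhabited : ∃ L
    U-inhabited : ∃ U
    L-lower     : ∀ {q r} → q < r → L r → L q
    U-upper     : ∀ {q r} → q < r → U q → U r
    L-open      : ∀ {q} → L q → ∃ λ r → q < r × L r
    U-open      : ∀ {r} → U r → ∃ λ q → q < r × U q
    disjoint    : ∀ {q} → L q → U q → ⊥
    located     : ∀ {q r} → q < r → L q ⊎ U r

open ℝ public

fromℚ : ℚ → ℝ
fromℚ p = record
  { L           = _< p
  ; U           = p <_
  ; L-inhabited = p + - 1ℚ
                , subst (p + - 1ℚ <_) (+-identityʳ p) (+-monoʳ-< p (negative⁻¹ (- 1ℚ)))
  ; U-inhabited = p + 1ℚ
                , subst (_< p + 1ℚ) (+-identityʳ p) (+-monoʳ-< p (positive⁻¹ 1ℚ))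
  ; L-lower     = <-trans
  ; U-upper     = λ q<r p<q → <-trans p<q q<r
  ; L-open      = λ q<p → let r , q<r , r<p = <-dense q<p in r , q<r , r<p
  ; U-open      = λ p<r → let q , p<q , q<r = <-dense p<r in q , q<r , p<q
  ; disjoint    = <-asym
  ; located     = loc
  }
  where
  loc : ∀ {q r} → q < r → q < p ⊎ p < r
  loc {q} {r} q<r with <-cmp q p
  ... | tri< q<p _ _    = inj₁ q<p
  ... | tri≈ _ refl _   = inj₂ q<r
  ... | tri> _ _ p<q    = inj₂ (<-trans p<q q<r)

infix 4 _≤ᴿ_ _≃ᴿ_

_≤ᴿ_ : ℝ → ℝ → Set
x ≤ᴿ y = ∀ q → L x q → L y q

_≃ᴿ_ : ℝ → ℝ → Set
x ≃ᴿ y = (x ≤ᴿ y) × (y ≤ᴿ x)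

-- y^r ≤ x for y ≥ 1 and rational r = a/b, b ≥ 1, by raising to the power b:
-- y^a ≤ x^b, or 1 ≤ x^b · y^∣a∣ if a < 0.
RatPow≤ : ℕ → ℚ → ℕ → Set
RatPow≤ y r x with ↥ r
... | + a      = y ℕ.^ a ℕ.≤ x ℕ.^ ↧ₙ r
... | -[1+ a ] = 1 ℕ.≤ x ℕ.^ ↧ₙ r ℕ.* y ℕ.^ suc a

-- y^c ≤ x for real c.  For y ≥ 1, y^c is the supremum of y^r over rational
-- r < c.  For y = 0: 0^c = 0 if c > 0, 0^0 = 1, and 0^c = ∞ if c < 0.
Pow≤ : ℕ → ℝ → ℕ → Set
Pow≤ zero      c x = L c 0ℚ ⊎ (c ≃ᴿ fromℚ 0ℚ × 1 ℕ.≤ x)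
Pow≤ y@(suc _) c x = ∀ r → L c r → RatPow≤ y r x

IsSup : (ℝ → Set) → ℝ → Set₁
IsSup S s = (∀ c → S c → c ≤ᴿ s) × (∀ u → (∀ c → S c → c ≤ᴿ u) → s ≤ᴿ u)

DominationExponent : Graph → Graph → ℝ → Set
DominationExponent F G c = ∀ (H : Graph) → Pow≤ (hom G H) c (hom F H)

-- IsHDE F G s : HDE(F, G) = s.  A supremum of reals cannot be computed constructively, so
-- HDE is given as a relation; `defined` is the condition F → G under which the
-- exponent is defined.
record IsHDE (F G : Graph) (s : ℝ) : Set₁ where
  field
    defined : 1 ℕ.≤ hom F G
    isSup   : IsSup (DominationExponent F G) s

{-# OPTIONS --safe #-}

-- Only edges present in both directions matter for paths, so hom (P (1 + k)) H is the number
-- w k of walks of length k in a symmetric graph.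
--
-- Lower bound, w (4n+1) ^ (4n+1) ≤ w 3 ^ (4n² + 3n + 1): take a uniformly random walk
-- x₀, x₁, … of length 4n+1 and let a k, d k be the expected logarithms of the number of walks
-- of length k from xₖ and of the degree of xₖ.  Gibbs' inequality on single edges of the walk
-- gives linear inequalities between a, d, log w (4n+1) and log w 3, and a nonnegative
-- combination of these is the claim.  Everything is exponentiated, an expected logarithm
-- becoming a finite product, so that only natural numbers occur.
--
-- Upper bound: complementary slackness in the same linear program dictates graphs, blown up
-- by a parameter k, with w 3 ≤ O(k ^ (4n+1)) and w (4n+1) ≥ k ^ (4n² + 3n + 1).
module Submission where

open import Defs
open import Algebra.Structures using (IsCommutativeMonoid)
open import Data.Bool using (Bool; true; false; T; _∧_; _∨_)
open import Data.Bool.Properties using (∧-comm; ∧-idem; T-∧)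
open import Data.Empty using (⊥; ⊥-elim)
open import Data.Fin using (Fin; zero; suc; toℕ; inject≤; _↑ˡ_; _↑ʳ_; combine; finToFun; funToFin)
open import Data.Fin.Properties using (remQuot-combine; toℕ-inject≤; finToFun-funToFin)
open import Data.Integer using (+_; -[1+_])
import Data.Integer as ℤ
import Data.Integer.Properties as ℤ
open import Data.List
  using (List; []; _∷_; _++_; map; concatMap; cartesianProduct; filter; length; lookup; allFin; upTo)
open import Data.List.Membership.Propositional using (lose)
open import Data.List.Membership.Propositional.Properties using (∈-allFin; ∈-map⁺)
open import Data.List.Properties using (filter-some; map-tabulate; map-upTo; tabulate-lookup)
open import Data.Nat
  using (ℕ; zero; suc; pred; _+_; _*_; _∸_; _^_; _≤_; _<_; _≡ᵇ_; z≤n; s≤s⁻¹; z<s; s<s; NonZero; >-nonZero)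
open import Data.Nat.Properties
open import Data.Nat.Tactic.RingSolver using (solve-∀)
open import Data.Product using (_×_; _,_; proj₁; proj₂; ∃-syntax)
open import Data.Rational using (ℚ; mkℚ; 0ℚ; _/_)
import Data.Rational as ℚ
import Data.Rational.Properties as ℚ
open import Data.Rational.Unnormalised using (mkℚᵘ; *<*)
import Data.Rational.Unnormalised.Properties as ℚᵘ
open import Data.Sum using (inj₁)
open import Data.Unit using (tt)
import Data.Vec.Functional as Vector
open import Function using (_∘_; id; Equivalence)
open import Relation.Binary.PropositionalEquality
  using (_≡_; _≗_; refl; sym; trans; cong; cong₂; subst; subst₂; module ≡-Reasoning)
open import Relation.Nullary using (Dec; yes; no; does)
open import Relation.Unary using (Decidable)


-- Finite sums and products

-- Write h = log w (4n+1), t = log w 3, and let d k be the expected log-degree at position k. The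
-- inequalities repeat with period four because bounds on d k + d (k+1) alternate in direction. From
-- a (4j) ≤ j t one gets d (4j) + d (4j+1) ≤ (n+1) t - h, then d (4i+1) + d (4i+2) ≥ h - n t, and d
-- (4i+2) + d (4i+3) ≤ (n+1) t - h. Eliminating with the help of reversal, d (4i+2) ≥ (2i+1) (2h -
-- (2n+1) t). The values at i = 0 and i = n-1 belong, after reversal, to adjacent positions, so 2n
-- (2h - (2n+1) t) ≤ (n+1) t - h. This is (4n+1) h ≤ (4n² + 3n + 1) t, the origin of both constants.
--
-- Subtracting logarithms means cancelling factors of natural numbers, so these must be nonzero; the
-- convention 0 ^ 0 = 1 guarantees this. The constant factor lost in w 3 on the extremal graphs is
-- harmless because k is unbounded.

module BigOperator {_∙_ : ℕ → ℕ → ℕ} {ε : ℕ} (M : IsCommutativeMonoid _≡_ _∙_ ε) where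
  open IsCommutativeMonoid M using (assoc; comm; identityˡ)

  big : {A : Set} → List A → (A → ℕ) → ℕ
  big []       f = ε
  big (x ∷ xs) f = f x ∙ big xs f

  module _ {A : Set} where

    big-cong : ∀ (xs : List A) {f g} → (∀ x → f x ≡ g x) → big xs f ≡ big xs g
    big-cong []       f≗g = refl
    big-cong (x ∷ xs) f≗g = cong₂ _∙_ (f≗g x) (big-cong xs f≗g)

    big-++ : ∀ (xs ys : List A) f → big (xs ++ ys) f ≡ big xs f ∙ big ys f
    big-++ []       ys f = sym (identityˡ _)
    big-++ (x ∷ xs) ys f = trans (cong (f x ∙_) (big-++ xs ys f)) (sym (assoc _ _ _))

    interchange : ∀ a b c d → (a ∙ b) ∙ (c ∙ d) ≡ (a ∙ c) ∙ (b ∙ d)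
    interchange a b c d = begin
      (a ∙ b) ∙ (c ∙ d)  ≡⟨ assoc a b _ ⟩
      a ∙ (b ∙ (c ∙ d))  ≡⟨ cong (a ∙_) (assoc b c d) ⟨
      a ∙ ((b ∙ c) ∙ d)  ≡⟨ cong (λ z → a ∙ (z ∙ d)) (comm b c) ⟩
      a ∙ ((c ∙ b) ∙ d)  ≡⟨ cong (a ∙_) (assoc c b d) ⟩
      a ∙ (c ∙ (b ∙ d))  ≡⟨ assoc a c _ ⟨
      (a ∙ c) ∙ (b ∙ d)  ∎
      where open ≡-Reasoning

    big-∙ : ∀ (xs : List A) f g → big xs (λ x → f x ∙ g x) ≡ big xs f ∙ big xs g
    big-∙ []       f g = sym (identityˡ ε)
    big-∙ (x ∷ xs) f g = trans (cong (_ ∙_) (big-∙ xs f g)) (interchange _ _ _ _)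

    big-ε : ∀ (xs : List A) → big xs (λ _ → ε) ≡ ε
    big-ε []       = refl
    big-ε (x ∷ xs) = trans (identityˡ _) (big-ε xs)

  module _ {A B : Set} where

    big-map : ∀ (h : A → B) xs f → big (map h xs) f ≡ big xs (f ∘ h)
    big-map h []       f = refl
    big-map h (x ∷ xs) f = cong (_ ∙_) (big-map h xs f)

    big-concatMap : ∀ (h : A → List B) xs f →
      big (concatMap h xs) f ≡ big xs (λ x → big (h x) f)
    big-concatMap h []       f = refl
    big-concatMap h (x ∷ xs) f =
      trans (big-++ (h x) _ f) (cong (_ ∙_) (big-concatMap h xs f))

    big-swap : ∀ (xs : List A) (ys : List B) (f : A → B → ℕ) →
      big xs (λ x → big ys (f x)) ≡ big ys (λ y → big xs (λ x → f x y))
    big-swap []       ys f = sym (big-ε ys)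
    big-swap (x ∷ xs) ys f =
      trans (cong (big ys (f x) ∙_) (big-swap xs ys f)) (sym (big-∙ ys (f x) _))

  module _ {A B : Set} where

    big-× : ∀ (xs : List A) (ys : List B) f →
      big (cartesianProduct xs ys) f ≡ big xs (λ x → big ys (λ y → f (x , y)))
    big-× []       ys f = refl
    big-× (x ∷ xs) ys f =
      trans (big-++ (map (x ,_) ys) _ f) (cong₂ _∙_ (big-map (x ,_) ys f) (big-× xs ys f))

open BigOperator +-0-isCommutativeMonoid public using () renaming
  (big to ∑; big-cong to ∑-cong; big-++ to ∑-++; big-∙ to ∑-+; big-ε to ∑-0; big-map to ∑-map;
   big-concatMap to ∑-concatMap; big-swap to ∑-swap; big-× to ∑-×)

open BigOperator *-1-isCommutativeMonoid public using () renaming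
  (big to ∏; big-cong to ∏-cong; big-∙ to ∏-*; big-ε to ∏-1; big-swap to ∏-swap; big-× to ∏-×)

module _ {A : Set} where

  ∑-mono-≤ : ∀ (xs : List A) {f g} → (∀ x → f x ≤ g x) → ∑ xs f ≤ ∑ xs g
  ∑-mono-≤ []       f≤g = z≤n
  ∑-mono-≤ (x ∷ xs) f≤g = +-mono-≤ (f≤g x) (∑-mono-≤ xs f≤g)

  ∏-mono-≤ : ∀ (xs : List A) {f g} → (∀ x → f x ≤ g x) → ∏ xs f ≤ ∏ xs g
  ∏-mono-≤ []       f≤g = ≤-refl
  ∏-mono-≤ (x ∷ xs) f≤g = *-mono-≤ (f≤g x) (∏-mono-≤ xs f≤g)

  *-∑ : ∀ c (xs : List A) f → c * ∑ xs f ≡ ∑ xs (λ x → c * f x)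
  *-∑ c []       f = *-zeroʳ c
  *-∑ c (x ∷ xs) f = trans (*-distribˡ-+ c (f x) _) (cong (λ z → c * f x + z) (*-∑ c xs f))

  ∑-* : ∀ c (xs : List A) f → ∑ xs f * c ≡ ∑ xs (λ x → f x * c)
  ∑-* c xs f = trans (*-comm _ c) (trans (*-∑ c xs f) (∑-cong xs (λ x → *-comm c (f x))))

  ^-∑ : ∀ b (xs : List A) f → b ^ ∑ xs f ≡ ∏ xs (λ x → b ^ f x)
  ^-∑ b []       f = refl
  ^-∑ b (x ∷ xs) f = trans (^-distribˡ-+-* b (f x) _) (cong (b ^ f x *_) (^-∑ b xs f))

  ∏-nonZero : ∀ (xs : List A) {f} → (∀ x → NonZero (f x)) → NonZero (∏ xs f)
  ∏-nonZero []       nz = _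
  ∏-nonZero (x ∷ xs) nz = m*n≢0 _ _ {{nz x}} {{∏-nonZero xs nz}}

-- Powers, the AM-GM inequality and the log-sum inequality

^-distribʳ-* : ∀ m n o → (n * o) ^ m ≡ n ^ m * o ^ m
^-distribʳ-* zero    n o = refl
^-distribʳ-* (suc m) n o = trans (cong (n * o *_) (^-distribʳ-* m n o)) (swap n o (n ^ m) (o ^ m))
  where
  swap : ∀ a b c d → a * b * (c * d) ≡ a * c * (b * d)
  swap = solve-∀

∏-^ : ∀ {A : Set} k (xs : List A) f → ∏ xs f ^ k ≡ ∏ xs (λ x → f x ^ k)
∏-^ k []       f = ^-zeroˡ k
∏-^ k (x ∷ xs) f = trans (^-distribʳ-* k (f x) _) (cong (f x ^ k *_) (∏-^ k xs f))

n^n≢0 : ∀ n → NonZero (n ^ n)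
n^n≢0 zero    = _
n^n≢0 (suc n) = m^n≢0 (suc n) (suc n)

^-cancelˡ-≤ : ∀ k .{{_ : NonZero k}} {m n} → m ^ k ≤ n ^ k → m ≤ n
^-cancelˡ-≤ k mᵏ≤nᵏ = ≮⇒≥ λ n<m → <⇒≱ (^-monoˡ-< k n<m) mᵏ≤nᵏ

-- In place of squaring a difference, both numbers are lowered by one, which changes the two sides
-- by the same amount, until one of them is zero.
2xy≤x²+y² : ∀ x y → 2 * (x * y) ≤ x * x + y * y
2xy≤x²+y² zero    y       = z≤n
2xy≤x²+y² (suc x) zero    = subst (_≤ suc x * suc x + 0) (sym (cong (2 *_) (*-zeroʳ x))) z≤n
2xy≤x²+y² (suc x) (suc y) = subst₂ _≤_ (eq₁ x y) (eq₂ x y) (+-monoˡ-≤ (2 * x + 2 * y + 2) (2xy≤x²+y² x y))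
  where
  eq₁ : ∀ x y → 2 * (x * y) + (2 * x + 2 * y + 2) ≡ 2 * (suc x * suc y)
  eq₁ = solve-∀
  eq₂ : ∀ x y → x * x + y * y + (2 * x + 2 * y + 2) ≡ suc x * suc x + suc y * suc y
  eq₂ = solve-∀

-- Bernoulli's inequality for p / q, cleared of denominators.
bernoulli : ∀ k p q → suc k * (p * q ^ k) ≤ p ^ suc k + k * q ^ suc k
bernoulli zero    p q = ≤-reflexive (eq p)
  where
  eq : ∀ p → 1 * (p * 1) ≡ p * 1 + 0
  eq = solve-∀
-- Multiplied by `p`, the induction hypothesis leaves the cross term `k * (p * (q * Q))` on the
-- right; added on the left, it completes the coefficient to `2 * (k + 1)`.
bernoulli (suc k) p q = +-cancelʳ-≤ (k * (p * (q * Q))) _ _ (begin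
  suc (suc k) * (p * (q * Q)) + k * (p * (q * Q))      ≡⟨ eq₁ k p q Q ⟩
  (k + 1) * Q * (2 * (p * q))                          ≤⟨ *-monoʳ-≤ ((k + 1) * Q) (2xy≤x²+y² p q) ⟩
  (k + 1) * Q * (p * p + q * q)                        ≡⟨ eq₂ k p q Q ⟩
  p * (suc k * (p * Q)) + suc k * (q * (q * Q))        ≤⟨ +-monoˡ-≤ (suc k * (q * (q * Q))) (*-monoʳ-≤ p (bernoulli k p q)) ⟩
  p * (p * p ^ k + k * (q * Q)) + suc k * (q * (q * Q)) ≡⟨ eq₃ k p q Q (p ^ k) ⟩
  p * (p * p ^ k) + suc k * (q * (q * Q)) + k * (p * (q * Q)) ∎)
  where
  open ≤-Reasoning
  Q = q ^ k
  eq₁ : ∀ k p q Q → suc (suc k) * (p * (q * Q)) + k * (p * (q * Q)) ≡ (k + 1) * Q * (2 * (p * q))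
  eq₁ = solve-∀
  eq₂ : ∀ k p q Q → (k + 1) * Q * (p * p + q * q) ≡ p * (suc k * (p * Q)) + suc k * (q * (q * Q))
  eq₂ = solve-∀
  eq₃ : ∀ k p q Q P → p * (p * P + k * (q * Q)) + suc k * (q * (q * Q))
      ≡ p * (p * P) + suc k * (q * (q * Q)) + k * (p * (q * Q))
  eq₃ = solve-∀

-- Adjoining z to n numbers with sum S.
am-gm-step : ∀ n S z → suc n ^ suc n * (z * S ^ n) ≤ n ^ n * (S + z) ^ suc n
am-gm-step zero    S z = subst₂ _≤_ (eq z) (eq (S + z)) (m≤n+m z S)
  where
  eq : ∀ z → z ≡ 1 * (z * 1)
  eq = solve-∀
am-gm-step n@(suc n-1) S z = *-cancelˡ-≤ n (+-cancelʳ-≤ (n * q ^ suc n) _ _ (begin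
  n * (suc n ^ suc n * (z * S ^ n)) + n * q ^ suc n
    ≡⟨ cong (λ w → n * (suc n ^ suc n * (z * S ^ n)) + n * w) (^-distribʳ-* (suc n) (suc n) S) ⟩
  n * (suc n ^ suc n * (z * S ^ n)) + n * (suc n ^ suc n * (S * S ^ n))
    ≡⟨ eq₁ n z S (suc n ^ n) (S ^ n) ⟩
  suc n * (n * (S + z) * (suc n ^ n * S ^ n))
    ≡⟨ cong (λ w → suc n * (n * (S + z) * w)) (^-distribʳ-* n (suc n) S) ⟨
  suc n * (n * (S + z) * q ^ n)
    -- The ratio of `n * (S + z)` to `q` is that of the new mean `(S + z) / (n + 1)` to the old mean
    -- `S / n`.
    ≤⟨ bernoulli n (n * (S + z)) q ⟩
  (n * (S + z)) ^ suc n + n * q ^ suc n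
    ≡⟨ cong (_+ n * q ^ suc n) (trans (^-distribʳ-* (suc n) n (S + z)) (*-assoc n (n ^ n) _)) ⟩
  n * (n ^ n * (S + z) ^ suc n) + n * q ^ suc n ∎))
  where
  open ≤-Reasoning
  q = suc n * S
  eq₁ : ∀ n z S a b → n * ((suc n * a) * (z * b)) + n * ((suc n * a) * (S * b))
      ≡ suc n * (n * (S + z) * (a * b))
  eq₁ = solve-∀

-- AM-GM for `a` copies of `x` and `b` copies of `y`: `am-gm-step` adjoins the copies of `y` one at
-- a time.
weighted-am-gm : ∀ a b x y → (a + b) ^ (a + b) * (x ^ a * y ^ b) ≤ (a * x + b * y) ^ (a + b)
weighted-am-gm a zero x y = ≤-reflexive (begin
  (a + 0) ^ (a + 0) * (x ^ a * 1)  ≡⟨ cong₂ (λ u v → u ^ u * v) (+-identityʳ a) (*-identityʳ (x ^ a)) ⟩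
  a ^ a * x ^ a                    ≡⟨ ^-distribʳ-* a a x ⟨
  (a * x) ^ a                      ≡⟨ cong₂ _^_ (+-identityʳ (a * x)) (+-identityʳ a) ⟨
  (a * x + 0) ^ (a + 0)            ∎)
  where open ≡-Reasoning
weighted-am-gm a (suc b) x y = *-cancelˡ-≤ (s ^ s) {{n^n≢0 s}} (begin
  s ^ s * ((a + suc b) ^ (a + suc b) * (x ^ a * (y * y ^ b)))
    ≡⟨ cong (λ w → s ^ s * (w ^ w * (x ^ a * (y * y ^ b)))) (+-suc a b) ⟩
  s ^ s * (suc s ^ suc s * (x ^ a * (y * y ^ b)))
    ≡⟨ eq₁ (s ^ s) (suc s ^ suc s) (x ^ a) y (y ^ b) ⟩
  suc s ^ suc s * (y * (s ^ s * (x ^ a * y ^ b)))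
    ≤⟨ *-monoʳ-≤ (suc s ^ suc s) (*-monoʳ-≤ y (weighted-am-gm a b x y)) ⟩
  suc s ^ suc s * (y * (a * x + b * y) ^ s)
    ≤⟨ am-gm-step s (a * x + b * y) y ⟩
  s ^ s * (a * x + b * y + y) ^ suc s
    ≡⟨ cong₂ (λ u v → s ^ s * u ^ v) (eq₂ a b x y) (sym (+-suc a b)) ⟩
  s ^ s * (a * x + suc b * y) ^ (a + suc b) ∎)
  where
  open ≤-Reasoning
  s = a + b
  eq₁ : ∀ s t x y z → s * (t * (x * (y * z))) ≡ t * (y * (s * (x * z)))
  eq₁ = solve-∀
  eq₂ : ∀ a b x y → a * x + b * y + y ≡ a * x + suc b * y
  eq₂ = solve-∀

-- Weighted AM-GM for `x / a` and `y / b`, scaled by `a * b` to stay in the naturals. With a zero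
-- weight the scaling cannot be cancelled, but monotonicity of powers suffices.
log-sum₂ : ∀ a b x y →
  (a + b) ^ (a + b) * (x ^ a * y ^ b) ≤ (x + y) ^ (a + b) * (a ^ a * b ^ b)
log-sum₂ zero b x y = begin
  b ^ b * (1 * y ^ b)        ≡⟨ eq₁ (b ^ b) (y ^ b) ⟩
  y ^ b * (1 * b ^ b)        ≤⟨ *-monoˡ-≤ (1 * b ^ b) (^-monoˡ-≤ b (m≤n+m y x)) ⟩
  (x + y) ^ b * (1 * b ^ b)  ∎
  where
  open ≤-Reasoning
  eq₁ : ∀ u v → u * (1 * v) ≡ v * (1 * u)
  eq₁ = solve-∀
log-sum₂ a@(suc _) zero x y = begin
  (a + 0) ^ (a + 0) * (x ^ a * 1)  ≡⟨ cong₂ (λ u v → u ^ u * v) (+-identityʳ a) (*-identityʳ (x ^ a)) ⟩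
  a ^ a * x ^ a                    ≡⟨ *-comm (a ^ a) (x ^ a) ⟩
  x ^ a * a ^ a                    ≤⟨ *-monoˡ-≤ (a ^ a) (^-monoˡ-≤ a (m≤m+n x y)) ⟩
  (x + y) ^ a * a ^ a              ≡⟨ cong₂ (λ u v → (x + y) ^ u * v) (+-identityʳ a) (*-identityʳ (a ^ a)) ⟨
  (x + y) ^ (a + 0) * (a ^ a * 1)  ∎
  where open ≤-Reasoning
log-sum₂ a@(suc _) b@(suc _) x y = *-cancelʳ-≤ _ _ (b ^ a * a ^ b) {{m*n≢0 _ _ {{m^n≢0 b a}} {{m^n≢0 a b}}}} (begin
  s ^ s * (x ^ a * y ^ b) * (b ^ a * a ^ b)
    ≡⟨ eq₁ (s ^ s) (x ^ a) (y ^ b) (b ^ a) (a ^ b) ⟩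
  s ^ s * ((b ^ a * x ^ a) * (a ^ b * y ^ b))
    ≡⟨ cong₂ (λ u v → s ^ s * (u * v)) (^-distribʳ-* a b x) (^-distribʳ-* b a y) ⟨
  s ^ s * ((b * x) ^ a * (a * y) ^ b)
    ≤⟨ weighted-am-gm a b (b * x) (a * y) ⟩
  (a * (b * x) + b * (a * y)) ^ s
    ≡⟨ cong (_^ s) (eq₂ a b x y) ⟩
  (a * b * (x + y)) ^ s
    ≡⟨ trans (^-distribʳ-* s (a * b) (x + y)) (cong (_* (x + y) ^ s) (^-distribʳ-* s a b)) ⟩
  a ^ s * b ^ s * (x + y) ^ s
    ≡⟨ cong₂ (λ u v → u * v * (x + y) ^ s) (^-distribˡ-+-* a a b) (^-distribˡ-+-* b a b) ⟩
  a ^ a * a ^ b * (b ^ a * b ^ b) * (x + y) ^ s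
    ≡⟨ eq₃ (a ^ a) (a ^ b) (b ^ a) (b ^ b) ((x + y) ^ s) ⟩
  (x + y) ^ s * (a ^ a * b ^ b) * (b ^ a * a ^ b) ∎)
  where
  open ≤-Reasoning
  s = a + b
  eq₁ : ∀ s x y u v → s * (x * y) * (u * v) ≡ s * ((u * x) * (v * y))
  eq₁ = solve-∀
  eq₂ : ∀ a b x y → a * (b * x) + b * (a * y) ≡ a * b * (x + y)
  eq₂ = solve-∀
  eq₃ : ∀ p q r t z → p * q * (r * t) * z ≡ z * (p * t) * (r * q)
  eq₃ = solve-∀

-- The log-sum inequality Σ c log (A / c) ≤ C log (Σ A / C), C = Σ c, exponentiated so
-- that it only involves natural numbers; 0 ^ 0 = 1 makes zero weights harmless.
log-sum : ∀ {I : Set} (is : List I) (A c : I → ℕ) →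
  ∑ is c ^ ∑ is c * ∏ is (λ i → A i ^ c i) ≤ ∑ is A ^ ∑ is c * ∏ is (λ i → c i ^ c i)
log-sum []       A c = ≤-refl
log-sum (i ∷ is) A c = *-cancelˡ-≤ (C ^ C) {{n^n≢0 C}} (begin
  C ^ C * (s ^ s * (A i ^ c i * ∏A))      ≡⟨ eq₁ (C ^ C) (s ^ s) (A i ^ c i) ∏A ⟩
  s ^ s * A i ^ c i * (C ^ C * ∏A)        ≤⟨ *-monoʳ-≤ (s ^ s * A i ^ c i) (log-sum is A c) ⟩
  s ^ s * A i ^ c i * (S ^ C * ∏c)        ≡⟨ eq₂ (s ^ s) (A i ^ c i) (S ^ C) ∏c ⟩
  s ^ s * (A i ^ c i * S ^ C) * ∏c        ≤⟨ *-monoˡ-≤ ∏c (log-sum₂ (c i) C (A i) S) ⟩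
  (A i + S) ^ s * (c i ^ c i * C ^ C) * ∏c ≡⟨ eq₃ ((A i + S) ^ s) (c i ^ c i) (C ^ C) ∏c ⟩
  C ^ C * ((A i + S) ^ s * (c i ^ c i * ∏c)) ∎)
  where
  open ≤-Reasoning
  C = ∑ is c
  S = ∑ is A
  s = c i + C
  ∏A = ∏ is (λ i → A i ^ c i)
  ∏c = ∏ is (λ i → c i ^ c i)
  eq₁ : ∀ a b c d → a * (b * (c * d)) ≡ b * c * (a * d)
  eq₁ = solve-∀
  eq₂ : ∀ a b c d → a * b * (c * d) ≡ a * (b * c) * d
  eq₂ = solve-∀
  eq₃ : ∀ a b c d → a * (b * c) * d ≡ c * (a * (b * d))
  eq₃ = solve-∀

-- Walks and their entropy

ind : Bool → ℕ
ind false = 0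
ind true  = 1

ind≤1 : ∀ b → ind b ≤ 1
ind≤1 false = z≤n
ind≤1 true  = ≤-refl

-- Off the edges the exponent vanishes together with the base, and `0 ^ 0 = 1`. So weights can be
-- restricted to edges without changing the product.
ind-^ : ∀ b x y → (ind b * x) ^ (ind b * y) ≡ x ^ (ind b * y)
ind-^ false x y = refl
ind-^ true  x y = cong (_^ (1 * y)) (*-identityˡ x)

module Walks {V : Set} (vs : List V) (adj : V → V → Bool) where

  α : V → V → ℕ
  α u v = ind (adj u v)

  walksFrom : ℕ → V → ℕ
  walksFrom zero    v = 1
  walksFrom (suc k) v = ∑ vs (λ u → α v u * walksFrom k u)

  walks : ℕ → ℕ
  walks k = ∑ vs (walksFrom k)

  module Symmetric (adj-sym : ∀ u v → adj u v ≡ adj v u) where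

    private
      s = walksFrom

      d : V → ℕ
      d = s 1

      pairs : List (V × V)
      pairs = cartesianProduct vs vs

      -- The number of walks of length k + 1 + l whose steps after the first k begin with (u , v).
      through : ℕ → ℕ → V × V → ℕ
      through k l (u , v) = α u v * (s k u * s l v)

    -- Summing out one endpoint of the edge lengthens by a step the walks counted from the other. In
    -- `through-right` the edge is traversed backwards, where symmetry enters.
    through-left : ∀ k l u → ∑ vs (λ v → through k l (u , v)) ≡ s k u * s (suc l) u
    through-left k l u = begin
      ∑ vs (λ v → α u v * (s k u * s l v))  ≡⟨ ∑-cong vs (λ v → swap (α u v) (s k u) (s l v)) ⟩
      ∑ vs (λ v → s k u * (α u v * s l v))  ≡⟨ *-∑ (s k u) vs _ ⟨
      s k u * s (suc l) u                   ∎
      where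
      open ≡-Reasoning
      swap : ∀ a b c → a * (b * c) ≡ b * (a * c)
      swap = solve-∀

    through-right : ∀ k l v → ∑ vs (λ u → through k l (u , v)) ≡ s (suc k) v * s l v
    through-right k l v = begin
      ∑ vs (λ u → α u v * (s k u * s l v))  ≡⟨ ∑-cong vs (λ u → cong (λ b → ind b * (s k u * s l v)) (adj-sym u v)) ⟩
      ∑ vs (λ u → α v u * (s k u * s l v))  ≡⟨ ∑-cong vs (λ u → *-assoc (α v u) (s k u) (s l v)) ⟨
      ∑ vs (λ u → α v u * s k u * s l v)    ≡⟨ ∑-* (s l v) vs _ ⟨
      s (suc k) v * s l v                   ∎
      where open ≡-Reasoning

    ∑-through : ∀ k l → ∑ pairs (through k l) ≡ ∑ vs (λ u → s k u * s (suc l) u)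
    ∑-through k l = trans (∑-× vs vs _) (∑-cong vs (through-left k l))

    -- Both marginals of `through k l` have the same total, so the vertex at which a walk is split
    -- can be moved one step at a time.
    walks-+ : ∀ k l → ∑ vs (λ v → s k v * s l v) ≡ walks (k + l)
    walks-+ zero    l = ∑-cong vs (λ v → +-identityʳ (s l v))
    walks-+ (suc k) l = begin
      ∑ vs (λ v → s (suc k) v * s l v)                ≡⟨ ∑-cong vs (through-right k l) ⟨
      ∑ vs (λ v → ∑ vs (λ u → through k l (u , v)))   ≡⟨ ∑-swap vs vs (λ v u → through k l (u , v)) ⟩
      ∑ vs (λ u → ∑ vs (λ v → through k l (u , v)))   ≡⟨ ∑-cong vs (through-left k l) ⟩
      ∑ vs (λ u → s k u * s (suc l) u)                ≡⟨ walks-+ k (suc l) ⟩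
      walks (k + suc l)                               ≡⟨ cong walks (+-suc k l) ⟩
      walks (suc k + l)                               ∎
      where open ≡-Reasoning

    -- exp (N · E[log g(x)]), where x is the vertex reached after k steps of a uniformly random
    -- walk of length k + l, and N = walks (k + l).
    expectation : ℕ → ℕ → (V → ℕ) → ℕ
    expectation k l g = ∏ vs (λ v → g v ^ (s k v * s l v))

    -- Exchanging the arguments reverses the walk. This preserves `D`, but in `A` it also changes
    -- which walk count is averaged.
    A : ℕ → ℕ → ℕ
    A k l = expectation k l (s k)

    D : ℕ → ℕ → ℕ
    D k l = expectation k l d

    ∏-left : ∀ k l g → ∏ pairs (λ (u , v) → g u ^ through k l (u , v)) ≡ expectation k (suc l) g
    ∏-left k l g = trans (∏-× vs vs _) (∏-cong vs λ u →
      trans (sym (^-∑ (g u) vs _)) (cong (g u ^_) (through-left k l u)))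

    ∏-right : ∀ k l g → ∏ pairs (λ (u , v) → g v ^ through k l (u , v)) ≡ expectation (suc k) l g
    ∏-right k l g = trans (∏-× vs vs _) (trans (∏-swap vs vs _) (∏-cong vs λ v →
      trans (sym (^-∑ (g v) vs _)) (cong (g v ^_) (through-right k l v))))

    expectation-* : ∀ k l f g →
      expectation k l (λ v → f v * g v) ≡ expectation k l f * expectation k l g
    expectation-* k l f g = trans (∏-cong vs (λ v → ^-distribʳ-* (s k v * s l v) (f v) (g v))) (∏-* vs _ _)

    expectation-comm : ∀ k l g → expectation k l g ≡ expectation l k g
    expectation-comm k l g = ∏-cong vs (λ v → cong (g v ^_) (*-comm (s k v) (s l v)))

    -- Gibbs' inequality for the distribution of an edge of a uniformly random walk against
    -- the product weights f ⊗ g on the edges.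
    gibbs : ∀ k l (f g : V → ℕ) →
      let N = walks (k + suc l) in
      N ^ N * (expectation k (suc l) f * expectation (suc k) l g)
        ≤ ∑ pairs (λ (u , v) → α u v * (f u * g v)) ^ N * (A k (suc l) * A l (suc k))
    gibbs k l f g = begin
      N ^ N * (expectation k (suc l) f * expectation (suc k) l g)
        ≡⟨ cong (N ^ N *_) (product f g) ⟨
      N ^ N * ∏ pairs (λ (u , v) → (f u * g v) ^ through k l (u , v))
        ≡⟨ cong₂ (λ M P → M ^ M * P) mass
             (∏-cong pairs (λ (u , v) → ind-^ (adj u v) (f u * g v) (s k u * s l v))) ⟨
      M ^ M * ∏ pairs (λ e → weight e ^ through k l e)
        ≤⟨ log-sum pairs weight (through k l) ⟩
      ∑ pairs weight ^ M * ∏ pairs (λ e → through k l e ^ through k l e)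
        ≡⟨ cong₂ (λ M P → ∑ pairs weight ^ M * P) mass
             (∏-cong pairs (λ (u , v) → ind-^ (adj u v) (s k u * s l v) (s k u * s l v))) ⟩
      ∑ pairs weight ^ N * ∏ pairs (λ (u , v) → (s k u * s l v) ^ through k l (u , v))
        -- For a uniform walk the multiplicity of an edge is itself a product over its endpoints, so
        -- the entropy term splits into two expectations.
        ≡⟨ cong (∑ pairs weight ^ N *_) (trans (product (s k) (s l))
             (cong (A k (suc l) *_) (expectation-comm (suc k) l (s l)))) ⟩
      ∑ pairs weight ^ N * (A k (suc l) * A l (suc k)) ∎
      where
      open ≤-Reasoning
      N = walks (k + suc l)
      M = ∑ pairs (through k l)
      weight : V × V → ℕ
      weight (u , v) = α u v * (f u * g v)
      mass : M ≡ N
      mass = trans (∑-through k l) (walks-+ k (suc l))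
      product : ∀ f g → ∏ pairs (λ (u , v) → (f u * g v) ^ through k l (u , v))
        ≡ expectation k (suc l) f * expectation (suc k) l g
      product f g = begin-equality
        ∏ pairs (λ (u , v) → (f u * g v) ^ through k l (u , v))
          ≡⟨ ∏-cong pairs (λ (u , v) → ^-distribʳ-* (through k l (u , v)) (f u) (g v)) ⟩
        ∏ pairs (λ (u , v) → f u ^ through k l (u , v) * g v ^ through k l (u , v))
          ≡⟨ ∏-* pairs _ _ ⟩
        ∏ pairs (λ (u , v) → f u ^ through k l (u , v)) * ∏ pairs (λ (u , v) → g v ^ through k l (u , v))
          ≡⟨ cong₂ _*_ (∏-left k l f) (∏-right k l g) ⟩
        expectation k (suc l) f * expectation (suc k) l g ∎

    -- The base occurs as a factor of its own exponent, so a zero base only appears as `0 ^ 0`.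
    s-nonZero : ∀ k l v → NonZero (s k v ^ (s k v * s l v))
    s-nonZero k l v with s k v
    ... | zero  = _
    ... | suc m = m^n≢0 (suc m) (suc m * s l v)

    A-nonZero : ∀ k l → NonZero (A k l)
    A-nonZero k l = ∏-nonZero vs (s-nonZero k l)

    d≡0⇒s≡0 : ∀ k v → d v ≡ 0 → s (suc k) v ≡ 0
    d≡0⇒s≡0 k v dv≡0 = isolated vs dv≡0
      where
      isolated : ∀ us → ∑ us (λ u → α v u * 1) ≡ 0 → ∑ us (λ u → α v u * s k u) ≡ 0
      isolated []       _  = refl
      isolated (u ∷ us) eq with adj v u
      ... | false = isolated us eq

    -- An isolated vertex starts no walk of positive length, so its zero degree carries exponent
    -- zero.
    D-nonZero : ∀ k l → NonZero (D (suc k) l)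
    D-nonZero k l = ∏-nonZero vs positive
      where
      positive : ∀ v → NonZero (d v ^ (s (suc k) v * s l v))
      positive v with d v in eq
      ... | zero  rewrite d≡0⇒s≡0 k v eq = _
      ... | suc m = m^n≢0 (suc m) (s (suc k) v * s l v)

    A-0 : ∀ l → A 0 l ≡ 1
    A-0 l = trans (∏-cong vs (λ v → ^-zeroˡ (1 * s l v))) (∏-1 vs)

    -- The edge weights d u * d v add up to walks 3.
    gibbs-degrees : ∀ k l →
      let N = walks (k + suc l) in
      N ^ N * (D k (suc l) * D (suc k) l) ≤ walks 3 ^ N * (A k (suc l) * A l (suc k))
    gibbs-degrees k l = subst
      (λ S → N ^ N * (D k (suc l) * D (suc k) l) ≤ S ^ N * (A k (suc l) * A l (suc k)))
      mass (gibbs k l d d)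
      where
      N = walks (k + suc l)
      mass : ∑ pairs (λ (u , v) → α u v * (d u * d v)) ≡ walks 3
      mass = trans (∑-through 1 1) (walks-+ 1 2)

    -- Subadditivity of entropy: the edge (x , y) against independent endpoints.
    gibbs-independent : ∀ k l →
      let N = walks (k + suc l) in
      A (suc k) l * A (suc l) k ≤ N ^ N
    gibbs-independent k l = *-cancelˡ-≤ (N ^ N * (A k (suc l) * A l (suc k)))
      {{m*n≢0 _ _ {{n^n≢0 N}} {{m*n≢0 _ _ {{A-nonZero k (suc l)}} {{A-nonZero l (suc k)}}}}}} (begin
      N ^ N * (A k (suc l) * A l (suc k)) * (A (suc k) l * A (suc l) k)
        ≡⟨ cong₂ (λ x y → N ^ N * (A k (suc l) * x) * (A (suc k) l * y))
             (expectation-comm l (suc k) (s l)) (expectation-comm (suc l) k (s (suc l))) ⟩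
      N ^ N * (A k (suc l) * E (suc k) l (s l)) * (A (suc k) l * E k (suc l) (s (suc l)))
        ≡⟨ eq₁ (N ^ N) (A k (suc l)) (E (suc k) l (s l)) (A (suc k) l) (E k (suc l) (s (suc l))) ⟩
      N ^ N * (A k (suc l) * E k (suc l) (s (suc l)) * (A (suc k) l * E (suc k) l (s l)))
        ≡⟨ cong₂ (λ x y → N ^ N * (x * y)) (expectation-* k (suc l) (s k) (s (suc l)))
             (expectation-* (suc k) l (s (suc k)) (s l)) ⟨
      N ^ N * (E k (suc l) left * E (suc k) l right)
        ≤⟨ gibbs k l left right ⟩
      ∑ pairs (λ (u , v) → α u v * (left u * right v)) ^ N * (A k (suc l) * A l (suc k))
        ≤⟨ *-monoˡ-≤ (A k (suc l) * A l (suc k)) (^-monoˡ-≤ N mass) ⟩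
      (N * N) ^ N * (A k (suc l) * A l (suc k))
        ≡⟨ cong (_* (A k (suc l) * A l (suc k))) (^-distribʳ-* N N N) ⟩
      N ^ N * N ^ N * (A k (suc l) * A l (suc k))
        ≡⟨ eq₂ (N ^ N) (A k (suc l) * A l (suc k)) ⟩
      N ^ N * (A k (suc l) * A l (suc k)) * N ^ N ∎)
      where
      open ≤-Reasoning
      N = walks (k + suc l)
      E = expectation
      -- The unnormalised distributions of the two endpoints. Each has total `N`, and forgetting
      -- adjacency bounds the weight of all edges by `N * N`.
      left right : V → ℕ
      left  u = s k u * s (suc l) u
      right v = s (suc k) v * s l v
      eq₁ : ∀ n a b c d → n * (a * b) * (c * d) ≡ n * (a * d * (c * b))
      eq₁ = solve-∀
      eq₂ : ∀ n a → n * n * a ≡ n * a * n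
      eq₂ = solve-∀
      mass : ∑ pairs (λ (u , v) → α u v * (left u * right v)) ≤ N * N
      mass = begin
        ∑ pairs (λ (u , v) → α u v * (left u * right v))
          ≤⟨ ∑-mono-≤ pairs (λ (u , v) → ≤-trans (*-monoˡ-≤ (left u * right v) (ind≤1 (adj u v)))
               (≤-reflexive (*-identityˡ (left u * right v)))) ⟩
        ∑ pairs (λ (u , v) → left u * right v)
          ≡⟨ ∑-× vs vs _ ⟩
        ∑ vs (λ u → ∑ vs (λ v → left u * right v))
          ≡⟨ ∑-cong vs (λ u → *-∑ (left u) vs right) ⟨
        ∑ vs (λ u → left u * ∑ vs right)
          ≡⟨ ∑-* (∑ vs right) vs left ⟨
        ∑ vs left * ∑ vs right
          ≡⟨ cong₂ _*_ (walks-+ k (suc l)) (trans (walks-+ (suc k) l) (cong walks (sym (+-suc k l)))) ⟩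
        N * N ∎

    -- Given the vertex v of the walk, the preceding vertex is one of d v neighbours.
    gibbs-conditional : ∀ k l → A (suc k) l ≤ A k (suc l) * D (suc k) l
    gibbs-conditional k l = begin
      ∏ vs (λ v → s (suc k) v ^ (s (suc k) v * s l v))
        ≡⟨ ∏-cong vs (λ v → ^-*-assoc (s (suc k) v) (s (suc k) v) (s l v)) ⟨
      ∏ vs (λ v → (s (suc k) v ^ s (suc k) v) ^ s l v)
        ≤⟨ ∏-mono-≤ vs (λ v → ^-monoˡ-≤ (s l v) (conditional v)) ⟩
      ∏ vs (λ v → (d v ^ s (suc k) v * ∏ vs (λ u → s k u ^ (α v u * s k u))) ^ s l v)
        ≡⟨ ∏-cong vs (λ v → trans (^-distribʳ-* (s l v) (d v ^ s (suc k) v) _)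
             (cong₂ _*_ (^-*-assoc (d v) (s (suc k) v) (s l v)) (power v))) ⟩
      ∏ vs (λ v → d v ^ (s (suc k) v * s l v) * ∏ vs (λ u → s k u ^ through k l (u , v)))
        ≡⟨ ∏-* vs _ _ ⟩
      D (suc k) l * ∏ vs (λ v → ∏ vs (λ u → s k u ^ through k l (u , v)))
        ≡⟨ *-comm (D (suc k) l) _ ⟩
      ∏ vs (λ v → ∏ vs (λ u → s k u ^ through k l (u , v))) * D (suc k) l
        ≡⟨ cong (_* D (suc k) l) (trans (∏-swap vs vs (λ v u → s k u ^ through k l (u , v)))
             (trans (sym (∏-× vs vs (λ (u , v) → s k u ^ through k l (u , v)))) (∏-left k l (s k)))) ⟩
      A k (suc l) * D (suc k) l ∎
      where
      open ≤-Reasoning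
      -- Log-sum over the neighbours of `v` with unit weights: a distribution on `d v` points has
      -- entropy at most `log (d v)`.
      conditional : ∀ v → s (suc k) v ^ s (suc k) v
        ≤ d v ^ s (suc k) v * ∏ vs (λ u → s k u ^ (α v u * s k u))
      conditional v = subst₂ _≤_
        (trans (cong (s (suc k) v ^ s (suc k) v *_)
          (trans (∏-cong vs (λ u → trans (ind-^ (adj v u) 1 (s k u)) (^-zeroˡ (α v u * s k u)))) (∏-1 vs)))
          (*-identityʳ _))
        (cong (d v ^ s (suc k) v *_) (∏-cong vs (λ u → ind-^ (adj v u) (s k u) (s k u))))
        (log-sum vs (λ u → α v u * 1) (λ u → α v u * s k u))
      power : ∀ v → ∏ vs (λ u → s k u ^ (α v u * s k u)) ^ s l v
        ≡ ∏ vs (λ u → s k u ^ through k l (u , v))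
      power v = trans (∏-^ (s l v) vs _) (∏-cong vs (λ u → trans
        (^-*-assoc (s k u) (α v u * s k u) (s l v))
        (cong (s k u ^_) (trans (*-assoc (α v u) (s k u) (s l v))
          (cong (λ b → ind b * (s k u * s l v)) (adj-sym v u))))))

-- The linear program

-- h and t stand for N ^ N and walks 3 ^ N, N = walks (4n+1); p, q, r, u for A k at k = 0, 1, 2, 3
-- modulo 4; and x, y for D k at k = 0, 2 modulo 4 (reversing the walk gives the other residues).
-- The second argument is n - j for the first argument j of p, q, x, and n - 1 - i for r, u, y.
module LinearProgram
  (n h t : ℕ) {{h≢0 : NonZero h}}
  (p q x r u y : ℕ → ℕ → ℕ)
  (x≢0 : ∀ j j′ → NonZero (x j j′))
  (r≢0 : ∀ i i′ → NonZero (r i i′))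
  (y≢0 : ∀ i i′ → NonZero (y i i′))
  (p₀ : ∀ j′ → p 0 j′ ≡ 1)
  (q≤px : ∀ j j′ → j + j′ ≡ n → q j j′ ≤ p j j′ * x j′ j)
  (r≤qy : ∀ i i′ → suc i + i′ ≡ n → r i i′ ≤ q i (suc i′) * y i i′)
  (u≤ry : ∀ i i′ → suc i + i′ ≡ n → u i i′ ≤ r i i′ * y i′ i)
  (pr≤h : ∀ i i′ → suc i + i′ ≡ n → p (suc i) i′ * r i′ i ≤ h)
  (uu≤h : ∀ i i′ → suc i + i′ ≡ n → u i i′ * u i′ i ≤ h)
  (hxx≤tpp : ∀ j j′ → j + j′ ≡ n → h * (x j j′ * x j′ j) ≤ t * (p j j′ * p j′ j))
  (hxy≤tqu : ∀ i i′ → suc i + i′ ≡ n →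
    h * (x (suc i′) i * y i i′) ≤ t * (q i (suc i′) * u i′ i))
  where

  open ≤-Reasoning

  swap : ∀ i i′ → suc i + i′ ≡ n → suc i′ + i ≡ n
  swap i i′ eq = trans (cong suc (+-comm i′ i)) eq

  shift : ∀ i i′ → suc i + i′ ≡ n → i + suc i′ ≡ n
  shift i i′ eq = trans (+-suc i i′) eq

  -- Bounding `q` and `u` by the conditional inequalities produces exactly the two degree factors on
  -- the left, which cancel.
  h≤tpr : ∀ i i′ → suc i + i′ ≡ n → h ≤ t * (p i (suc i′) * r i′ i)
  h≤tpr i i′ eq = *-cancelʳ-≤ _ _ (x (suc i′) i * y i i′)
    {{m*n≢0 _ _ {{x≢0 (suc i′) i}} {{y≢0 i i′}}}} (begin
    h * (x (suc i′) i * y i i′)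
      ≤⟨ hxy≤tqu i i′ eq ⟩
    t * (q i (suc i′) * u i′ i)
      ≤⟨ *-monoʳ-≤ t (*-mono-≤ (q≤px i (suc i′) (shift i i′ eq)) (u≤ry i′ i (swap i i′ eq))) ⟩
    t * ((p i (suc i′) * x (suc i′) i) * (r i′ i * y i i′))
      ≡⟨ eq₁ t (p i (suc i′)) (x (suc i′) i) (r i′ i) (y i i′) ⟩
    t * (p i (suc i′) * r i′ i) * (x (suc i′) i * y i i′) ∎)
    where
    eq₁ : ∀ t p x r y → t * ((p * x) * (r * y)) ≡ t * (p * r) * (x * y)
    eq₁ = solve-∀

  -- `pr≤h` and `h≤tpr` share the factor `r i′ i`; cancelling it shows that `p` grows by at most a
  -- factor `t` per period.
  p≤tʲ : ∀ j j′ → j + j′ ≡ n → p j j′ ≤ t ^ j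
  p≤tʲ zero    j′ _  = ≤-reflexive (p₀ j′)
  p≤tʲ (suc i) i′ eq = *-cancelʳ-≤ _ _ (r i′ i) {{r≢0 i′ i}} (begin
    p (suc i) i′ * r i′ i         ≤⟨ pr≤h i i′ eq ⟩
    h                             ≤⟨ h≤tpr i i′ eq ⟩
    t * (p i (suc i′) * r i′ i)   ≤⟨ *-monoʳ-≤ t (*-monoˡ-≤ (r i′ i) (p≤tʲ i (suc i′) (shift i i′ eq))) ⟩
    t * (t ^ i * r i′ i)          ≡⟨ *-assoc t (t ^ i) (r i′ i) ⟨
    t ^ suc i * r i′ i            ∎)

  h≤tʲr : ∀ i i′ → suc i + i′ ≡ n → h ≤ t ^ suc i * r i′ i
  h≤tʲr i i′ eq = begin
    h                             ≤⟨ h≤tpr i i′ eq ⟩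
    t * (p i (suc i′) * r i′ i)   ≤⟨ *-monoʳ-≤ t (*-monoˡ-≤ (r i′ i) (p≤tʲ i (suc i′) (shift i i′ eq))) ⟩
    t * (t ^ i * r i′ i)          ≡⟨ *-assoc t (t ^ i) (r i′ i) ⟨
    t ^ suc i * r i′ i            ∎

  hxx≤tⁿ⁺¹ : ∀ j j′ → j + j′ ≡ n → h * (x j j′ * x j′ j) ≤ t ^ suc n
  hxx≤tⁿ⁺¹ j j′ eq = begin
    h * (x j j′ * x j′ j)    ≤⟨ hxx≤tpp j j′ eq ⟩
    t * (p j j′ * p j′ j)    ≤⟨ *-monoʳ-≤ t (*-mono-≤ (p≤tʲ j j′ eq) (p≤tʲ j′ j (trans (+-comm j′ j) eq))) ⟩
    t * (t ^ j * t ^ j′)     ≡⟨ cong (t *_) (^-distribˡ-+-* t j j′) ⟨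
    t * t ^ (j + j′)         ≡⟨ cong (λ m → t * t ^ m) eq ⟩
    t ^ suc n                ∎

  -- The lower bound on `r` from `h≤tʲr` meets the upper bound obtained by following two conditional
  -- steps back to `p`, leaving the degrees at those steps.
  h≤tⁿxy : ∀ i i′ → suc i + i′ ≡ n → h ≤ t ^ n * (x (suc i′) i * y i i′)
  h≤tⁿxy i i′ eq = begin
    h
      ≤⟨ h≤tʲr i′ i (swap i i′ eq) ⟩
    t ^ suc i′ * r i i′
      ≤⟨ *-monoʳ-≤ (t ^ suc i′) (begin
        r i i′                                  ≤⟨ r≤qy i i′ eq ⟩
        q i (suc i′) * y i i′                   ≤⟨ *-monoˡ-≤ (y i i′) (q≤px i (suc i′) (shift i i′ eq)) ⟩
        p i (suc i′) * x (suc i′) i * y i i′    ≤⟨ *-monoˡ-≤ (y i i′) (*-monoˡ-≤ (x (suc i′) i)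
                                                     (p≤tʲ i (suc i′) (shift i i′ eq))) ⟩
        t ^ i * x (suc i′) i * y i i′           ∎) ⟩
    t ^ suc i′ * (t ^ i * x (suc i′) i * y i i′)
      ≡⟨ eq₁ (t ^ suc i′) (t ^ i) (x (suc i′) i) (y i i′) ⟩
    t ^ suc i′ * t ^ i * (x (suc i′) i * y i i′)
      ≡⟨ cong (_* (x (suc i′) i * y i i′)) (^-distribˡ-+-* t (suc i′) i) ⟨
    t ^ (suc i′ + i) * (x (suc i′) i * y i i′)
      ≡⟨ cong (λ m → t ^ m * (x (suc i′) i * y i i′)) (swap i i′ eq) ⟩
    t ^ n * (x (suc i′) i * y i i′) ∎
    where
    eq₁ : ∀ a b c d → a * (b * c * d) ≡ a * b * (c * d)
    eq₁ = solve-∀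

  hy≤tpu : ∀ i i′ → suc i + i′ ≡ n → h * y i i′ ≤ t ^ suc i * u i′ i
  hy≤tpu i i′ eq = *-cancelʳ-≤ _ _ (x (suc i′) i) {{x≢0 (suc i′) i}} (begin
    h * y i i′ * x (suc i′) i                     ≡⟨ eq₁ h (y i i′) (x (suc i′) i) ⟩
    h * (x (suc i′) i * y i i′)                   ≤⟨ hxy≤tqu i i′ eq ⟩
    t * (q i (suc i′) * u i′ i)                   ≤⟨ *-monoʳ-≤ t (*-monoˡ-≤ (u i′ i) (q≤px i (suc i′) (shift i i′ eq))) ⟩
    t * (p i (suc i′) * x (suc i′) i * u i′ i)    ≤⟨ *-monoʳ-≤ t (*-monoˡ-≤ (u i′ i) (*-monoˡ-≤ (x (suc i′) i)
                                                     (p≤tʲ i (suc i′) (shift i i′ eq)))) ⟩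
    t * (t ^ i * x (suc i′) i * u i′ i)           ≡⟨ eq₂ t (t ^ i) (x (suc i′) i) (u i′ i) ⟩
    t ^ suc i * u i′ i * x (suc i′) i             ∎)
    where
    eq₁ : ∀ a b c → a * b * c ≡ a * (c * b)
    eq₁ = solve-∀
    eq₂ : ∀ a b c d → a * (b * c * d) ≡ a * b * d * c
    eq₂ = solve-∀

  -- The counterpart of `hxx≤tⁿ⁺¹`, reached through `u`: of `r` only lower bounds are at hand,
  -- whereas the two `u` of a reversed pair are bounded by `uu≤h`.
  hyy≤tⁿ⁺¹ : ∀ i i′ → suc i + i′ ≡ n → h * (y i i′ * y i′ i) ≤ t ^ suc n
  hyy≤tⁿ⁺¹ i i′ eq = *-cancelʳ-≤ _ _ h (begin
    h * (y i i′ * y i′ i) * h                        ≡⟨ eq₁ h (y i i′) (y i′ i) ⟩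
    (h * y i i′) * (h * y i′ i)                      ≤⟨ *-mono-≤ (hy≤tpu i i′ eq) (hy≤tpu i′ i (swap i i′ eq)) ⟩
    (t ^ suc i * u i′ i) * (t ^ suc i′ * u i i′)     ≡⟨ eq₂ (t ^ suc i) (u i′ i) (t ^ suc i′) (u i i′) ⟩
    t ^ suc i * t ^ suc i′ * (u i i′ * u i′ i)       ≤⟨ *-monoʳ-≤ (t ^ suc i * t ^ suc i′) (uu≤h i i′ eq) ⟩
    t ^ suc i * t ^ suc i′ * h                       ≡⟨ cong (_* h) (^-distribˡ-+-* t (suc i) (suc i′)) ⟨
    t ^ suc (i + suc i′) * h                         ≡⟨ cong (λ m → t ^ suc m * h) (shift i i′ eq) ⟩
    t ^ suc n * h                                    ∎)
    where
    eq₁ : ∀ h a b → h * (a * b) * h ≡ (h * a) * (h * b)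
    eq₁ = solve-∀
    eq₂ : ∀ a b c d → (a * b) * (c * d) ≡ a * c * (d * b)
    eq₂ = solve-∀

  -- The two instances of `h≤tⁿxy` contain exactly the pair of `x` bounded above by `hxx≤tⁿ⁺¹`, so
  -- only the `y` survive.
  h³≤tyy : ∀ a b → suc a + suc b ≡ n →
    h * h * h ≤ t ^ n * t ^ n * t ^ suc n * (y (suc a) b * y (suc b) a)
  h³≤tyy a b eq = *-cancelʳ-≤ _ _ X
    {{m*n≢0 _ _ {{x≢0 (suc a) (suc b)}} {{x≢0 (suc b) (suc a)}}}} (begin
    h * h * h * X
      ≡⟨ eq₁ h X ⟩
    h * h * (h * X)
      ≤⟨ *-mono-≤ (*-mono-≤ (h≤tⁿxy (suc a) b (trans (sym (+-suc (suc a) b)) eq))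
                            (h≤tⁿxy (suc b) a (trans (sym (+-suc (suc b) a)) eq′)))
                  (hxx≤tⁿ⁺¹ (suc a) (suc b) eq) ⟩
    t ^ n * (x (suc b) (suc a) * y (suc a) b) * (t ^ n * (x (suc a) (suc b) * y (suc b) a)) * t ^ suc n
      ≡⟨ eq₂ (t ^ n) (t ^ suc n) (x (suc a) (suc b)) (x (suc b) (suc a)) (y (suc a) b) (y (suc b) a) ⟩
    t ^ n * t ^ n * t ^ suc n * (y (suc a) b * y (suc b) a) * X ∎)
    where
    eq′ : suc b + suc a ≡ n
    eq′ = trans (+-comm (suc b) (suc a)) eq
    X = x (suc a) (suc b) * x (suc b) (suc a)
    eq₁ : ∀ h X → h * h * h * X ≡ h * h * (h * X)
    eq₁ = solve-∀
    eq₂ : ∀ a b x x′ y y′ → a * (x′ * y) * (a * (x * y′)) * b ≡ a * a * b * (y * y′) * (x * x′)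
    eq₂ = solve-∀

  h² t²ⁿ⁺¹ : ℕ
  h² = h * h
  t²ⁿ⁺¹ = t ^ n * t ^ suc n

  h²≤ty₀ : ∀ m → suc m ≡ n → h² ≤ t²ⁿ⁺¹ * y 0 m
  h²≤ty₀ m refl = *-cancelʳ-≤ _ _ (x n 0) {{x≢0 n 0}} (begin
    h * h * x n 0                          ≡⟨ *-assoc h h (x n 0) ⟩
    h * (h * x n 0)                        ≤⟨ *-monoʳ-≤ h (*-monoʳ-≤ h (m≤n*m (x n 0) (x 0 n) {{x≢0 0 n}})) ⟩
    h * (h * (x 0 n * x n 0))              ≤⟨ *-mono-≤ (h≤tⁿxy 0 m refl) (hxx≤tⁿ⁺¹ 0 n refl) ⟩
    t ^ n * (x n 0 * y 0 m) * t ^ suc n    ≡⟨ eq₁ (t ^ n) (x n 0) (y 0 m) (t ^ suc n) ⟩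
    t²ⁿ⁺¹ * y 0 m * x n 0                      ∎)
    where
    eq₁ : ∀ a b c d → a * (b * c) * d ≡ a * d * c * b
    eq₁ = solve-∀

  -- `h³≤tyy` bounds `y (suc a) b * y (suc b) a` below and `hyy≤tⁿ⁺¹` bounds
  -- `y a (suc b) * y (suc b) a` above. Cancelling the common factor, each step in `i` gains two
  -- more factors `h² / t²ⁿ⁺¹`.
  h²≤ty : ∀ i i′ → suc i + i′ ≡ n → h² ^ suc (i + i) ≤ t²ⁿ⁺¹ ^ suc (i + i) * y i i′
  h²≤ty zero    i′ eq = subst₂ _≤_ (sym (*-identityʳ h²)) (cong (_* y 0 i′) (sym (*-identityʳ t²ⁿ⁺¹))) (h²≤ty₀ i′ eq)
  h²≤ty (suc a) b  eq = *-cancelʳ-≤ _ _ (y a (suc b) * y (suc b) a)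
    {{m*n≢0 _ _ {{y≢0 a (suc b)}} {{y≢0 (suc b) a}}}} (begin
    h² ^ suc (suc a + suc a) * (y a (suc b) * y (suc b) a)
      ≡⟨ cong (λ m → h² ^ suc (suc m) * (y a (suc b) * y (suc b) a)) (+-suc a a) ⟩
    h² * (h² * h² ^ suc (a + a)) * (y a (suc b) * y (suc b) a)
      ≡⟨ eq₁ h (h² ^ suc (a + a)) (y a (suc b) * y (suc b) a) ⟩
    h² ^ suc (a + a) * (h * h * h) * (h * (y a (suc b) * y (suc b) a))
      ≤⟨ *-mono-≤ (*-mono-≤ (h²≤ty a (suc b) eq′) (h³≤tyy a b eq′)) (hyy≤tⁿ⁺¹ a (suc b) eq′) ⟩
    t²ⁿ⁺¹ ^ suc (a + a) * y a (suc b) * (t ^ n * t ^ n * t ^ suc n * (y (suc a) b * y (suc b) a)) * t ^ suc n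
      ≡⟨ eq₂ (t ^ n) (t ^ suc n) (t²ⁿ⁺¹ ^ suc (a + a)) (y a (suc b)) (y (suc a) b) (y (suc b) a) ⟩
    t²ⁿ⁺¹ * (t²ⁿ⁺¹ * t²ⁿ⁺¹ ^ suc (a + a)) * y (suc a) b * (y a (suc b) * y (suc b) a)
      ≡⟨ cong (λ m → t²ⁿ⁺¹ ^ suc (suc m) * y (suc a) b * (y a (suc b) * y (suc b) a)) (+-suc a a) ⟨
    t²ⁿ⁺¹ ^ suc (suc a + suc a) * y (suc a) b * (y a (suc b) * y (suc b) a) ∎)
    where
    eq′ : suc a + suc b ≡ n
    eq′ = shift (suc a) b eq
    eq₁ : ∀ h H Y → h * h * (h * h * H) * Y ≡ H * (h * h * h) * (h * Y)
    eq₁ = solve-∀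
    eq₂ : ∀ a b c d e f → c * d * (a * a * b * (e * f)) * b ≡ (a * b) * ((a * b) * c) * e * (d * f)
    eq₂ = solve-∀

  -- The lower bounds at the two extreme indices carry `2n - 1` and `1` factors `h² / t²ⁿ⁺¹`.
  -- Against `hyy≤tⁿ⁺¹` the exponents become `2 * 2n + 1` and `2n * (2n + 1) + (n + 1)`.
  h⁴ⁿ⁺¹≤t : ∀ m → suc m ≡ n → h ^ (4 * n + 1) ≤ t ^ (1 + 3 * n + 4 * n ^ 2)
  h⁴ⁿ⁺¹≤t m refl = *-cancelʳ-≤ _ _ (y m 0 * y 0 m) {{m*n≢0 _ _ {{y≢0 m 0}} {{y≢0 0 m}}}} (begin
    h ^ (4 * n + 1) * (y m 0 * y 0 m)
      ≡⟨ cong (λ e → h ^ e * (y m 0 * y 0 m)) (eq₁ m) ⟩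
    h ^ (2 * suc (m + m) + 3) * (y m 0 * y 0 m)
      ≡⟨ cong (_* (y m 0 * y 0 m)) (^-distribˡ-+-* h (2 * suc (m + m)) 3) ⟩
    h ^ (2 * suc (m + m)) * h ^ 3 * (y m 0 * y 0 m)
      ≡⟨ cong (λ z → z * h ^ 3 * (y m 0 * y 0 m)) (^-*-assoc h 2 (suc (m + m))) ⟨
    (h ^ 2) ^ suc (m + m) * h ^ 3 * (y m 0 * y 0 m)
      ≡⟨ cong (λ z → (h * z) ^ suc (m + m) * h ^ 3 * (y m 0 * y 0 m)) (*-identityʳ h) ⟩
    h² ^ suc (m + m) * h ^ 3 * (y m 0 * y 0 m)
      ≡⟨ eq₂ h (h² ^ suc (m + m)) (y m 0 * y 0 m) ⟩
    h² ^ suc (m + m) * h² * (h * (y m 0 * y 0 m))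
      ≤⟨ *-mono-≤ (*-mono-≤ (h²≤ty m 0 last) (h²≤ty₀ m refl)) (hyy≤tⁿ⁺¹ m 0 last) ⟩
    t²ⁿ⁺¹ ^ suc (m + m) * y m 0 * (t²ⁿ⁺¹ * y 0 m) * t ^ suc n
      ≡⟨ eq₃ (t²ⁿ⁺¹ ^ suc (m + m)) (y m 0) t²ⁿ⁺¹ (y 0 m) (t ^ suc n) ⟩
    t²ⁿ⁺¹ ^ suc (suc (m + m)) * t ^ suc n * (y m 0 * y 0 m)
      ≡⟨ cong (λ z → z ^ suc (suc (m + m)) * t ^ suc n * (y m 0 * y 0 m)) (^-distribˡ-+-* t n (suc n)) ⟨
    (t ^ (n + suc n)) ^ suc (suc (m + m)) * t ^ suc n * (y m 0 * y 0 m)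
      ≡⟨ cong (λ z → z * t ^ suc n * (y m 0 * y 0 m)) (^-*-assoc t (n + suc n) (suc (suc (m + m)))) ⟩
    t ^ ((n + suc n) * suc (suc (m + m))) * t ^ suc n * (y m 0 * y 0 m)
      ≡⟨ cong (_* (y m 0 * y 0 m)) (^-distribˡ-+-* t ((n + suc n) * suc (suc (m + m))) (suc n)) ⟨
    t ^ ((n + suc n) * suc (suc (m + m)) + suc n) * (y m 0 * y 0 m)
      ≡⟨ cong (λ e → t ^ e * (y m 0 * y 0 m)) (eq₄ m) ⟩
    t ^ (1 + 3 * n + 4 * n ^ 2) * (y m 0 * y 0 m) ∎)
    where
    last : suc m + 0 ≡ n
    last = +-identityʳ (suc m)
    eq₁ : ∀ m → 4 * suc m + 1 ≡ 2 * suc (m + m) + 3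
    eq₁ = solve-∀
    eq₂ : ∀ h H Y → H * (h * (h * (h * 1))) * Y ≡ H * (h * h) * (h * Y)
    eq₂ = solve-∀
    eq₃ : ∀ a b c d e → a * b * (c * d) * e ≡ c * a * e * (b * d)
    eq₃ = solve-∀
    eq₄ : ∀ m → (suc m + suc (suc m)) * suc (suc (m + m)) + suc (suc m) ≡ 1 + 3 * suc m + 4 * (suc m * (suc m * 1))
    eq₄ = solve-∀

-- The lower bound for walks in a symmetric graph

module _ {V : Set} (vs : List V) (adj : V → V → Bool) (adj-sym : ∀ u v → adj u v ≡ adj v u) where

  open Walks vs adj
  open Symmetric adj-sym

  walks-dominated : ∀ m → let n = suc m in
    walks (4 * n + 1) ^ (4 * n + 1) ≤ walks 3 ^ (1 + 3 * n + 4 * n ^ 2)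
  walks-dominated m = go refl
    where
    open ≤-Reasoning
    n = suc m
    R = 1 + 3 * n + 4 * n ^ 2

    index : ∀ j j′ → j + j′ ≡ n → j * 4 + suc (j′ * 4) ≡ 4 * n + 1
    index j j′ eq = trans (lemma j j′) (cong (λ k → 4 * k + 1) eq)
      where
      lemma : ∀ j j′ → j * 4 + suc (j′ * 4) ≡ 4 * (j + j′) + 1
      lemma = solve-∀

    index′ : ∀ i i′ → suc i + i′ ≡ n → suc (suc (suc (i * 4))) + suc (suc (i′ * 4)) ≡ 4 * n + 1
    index′ i i′ eq = trans (lemma i i′) (cong (λ k → 4 * k + 1) eq)
      where
      lemma : ∀ i i′ → suc (suc (suc (i * 4))) + suc (suc (i′ * 4)) ≡ 4 * (suc i + i′) + 1
      lemma = solve-∀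

    index″ : ∀ i i′ → suc i + i′ ≡ n → suc (i * 4) + suc i′ * 4 ≡ 4 * n + 1
    index″ i i′ eq = trans (sym (+-suc (i * 4) (suc i′ * 4))) (index i (suc i′) (trans (+-suc i i′) eq))

    go : ∀ {N} → walks (4 * n + 1) ≡ N → N ^ (4 * n + 1) ≤ walks 3 ^ R
    -- Without walks no `N`-th root can be taken, but the left side is zero since its exponent is
    -- positive.
    go {zero}  _  = subst (λ e → 0 ^ e ≤ walks 3 ^ R) (+-comm 1 (4 * n)) z≤n
    go {suc N-1} eq = ^-cancelˡ-≤ N (begin
      (N ^ (4 * n + 1)) ^ N   ≡⟨ ^-^-comm N (4 * n + 1) ⟩
      (N ^ N) ^ (4 * n + 1)   ≤⟨ LP.h⁴ⁿ⁺¹≤t m refl ⟩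
      (walks 3 ^ N) ^ R       ≡⟨ ^-^-comm′ ⟩
      (walks 3 ^ R) ^ N       ∎)
      where
      N = suc N-1
      ^-^-comm : ∀ b e → (b ^ e) ^ N ≡ (b ^ N) ^ e
      ^-^-comm b e = trans (^-*-assoc b e N) (trans (cong (b ^_) (*-comm e N)) (sym (^-*-assoc b N e)))
      ^-^-comm′ = sym (^-^-comm (walks 3) R)
      at : ∀ {k} → k ≡ 4 * n + 1 → walks k ≡ N
      at k≡ = trans (cong walks k≡) eq
      module LP = LinearProgram n (N ^ N) (walks 3 ^ N) {{n^n≢0 N}}
        (λ j j′ → A (j * 4) (1 + j′ * 4))
        (λ j j′ → A (1 + j * 4) (j′ * 4))
        (λ j j′ → D (j * 4) (1 + j′ * 4))
        (λ i i′ → A (2 + i * 4) (3 + i′ * 4))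
        (λ i i′ → A (3 + i * 4) (2 + i′ * 4))
        (λ i i′ → D (2 + i * 4) (3 + i′ * 4))
        -- At `j = 0` only the reversed walk has the positive first length that `D-nonZero` asks
        -- for.
        (λ j j′ → subst NonZero (expectation-comm (1 + j′ * 4) (j * 4) _) (D-nonZero (j′ * 4) (j * 4)))
        (λ i i′ → A-nonZero (2 + i * 4) (3 + i′ * 4))
        (λ i i′ → D-nonZero (1 + i * 4) (3 + i′ * 4))
        (λ j′ → A-0 (1 + j′ * 4))
        (λ j j′ _ → subst (λ d → A (1 + j * 4) (j′ * 4) ≤ A (j * 4) (1 + j′ * 4) * d)
          (expectation-comm (1 + j * 4) (j′ * 4) _) (gibbs-conditional (j * 4) (j′ * 4)))
        (λ i i′ _ → gibbs-conditional (1 + i * 4) (3 + i′ * 4))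
        (λ i i′ _ → subst (λ d → A (3 + i * 4) (2 + i′ * 4) ≤ A (2 + i * 4) (3 + i′ * 4) * d)
          (expectation-comm (3 + i * 4) (2 + i′ * 4) _) (gibbs-conditional (2 + i * 4) (2 + i′ * 4)))
        (λ i i′ eq → subst (λ N → A (4 + i * 4) (1 + i′ * 4) * A (2 + i′ * 4) (3 + i * 4) ≤ N ^ N)
          (at (index′ i i′ eq)) (gibbs-independent (3 + i * 4) (1 + i′ * 4)))
        (λ i i′ eq → subst (λ N → A (3 + i * 4) (2 + i′ * 4) * A (3 + i′ * 4) (2 + i * 4) ≤ N ^ N)
          (at (trans (+-suc (2 + i * 4) (2 + i′ * 4)) (index′ i i′ eq))) (gibbs-independent (2 + i * 4) (2 + i′ * 4)))
        (λ j j′ eq → subst₂ _≤_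
          (cong₂ (λ N d → N ^ N * (D (j * 4) (1 + j′ * 4) * d)) (at (index j j′ eq))
            (expectation-comm (1 + j * 4) (j′ * 4) _))
          (cong (λ N → walks 3 ^ N * (A (j * 4) (1 + j′ * 4) * A (j′ * 4) (1 + j * 4))) (at (index j j′ eq)))
          (gibbs-degrees (j * 4) (j′ * 4)))
        (λ i i′ eq → subst₂ _≤_
          (cong₂ (λ N d → N ^ N * (d * D (2 + i * 4) (3 + i′ * 4))) (at (index″ i i′ eq))
            (expectation-comm (1 + i * 4) (4 + i′ * 4) _))
          (cong (λ N → walks 3 ^ N * (A (1 + i * 4) (4 + i′ * 4) * A (3 + i′ * 4) (2 + i * 4))) (at (index″ i i′ eq)))
          (gibbs-degrees (1 + i * 4) (3 + i′ * 4)))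

-- Homomorphisms from paths as walks

∑-allFin-suc : ∀ n f → ∑ (allFin (suc n)) f ≡ f zero + ∑ (allFin n) (f ∘ suc)
∑-allFin-suc n f = cong (λ z → f zero + z)
  (trans (cong (λ xs → ∑ xs f) (sym (map-tabulate id suc))) (∑-map suc (allFin n) f))

∑-allFin-+ : ∀ m n f →
  ∑ (allFin (m + n)) f ≡ ∑ (allFin m) (f ∘ (_↑ˡ n)) + ∑ (allFin n) (f ∘ (m ↑ʳ_))
∑-allFin-+ zero    n f = refl
∑-allFin-+ (suc m) n f = begin
  ∑ (allFin (suc m + n)) f
    ≡⟨ ∑-allFin-suc (m + n) f ⟩
  f zero + ∑ (allFin (m + n)) (f ∘ suc)
    ≡⟨ cong (λ z → f zero + z) (∑-allFin-+ m n (f ∘ suc)) ⟩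
  f zero + (∑ (allFin m) (f ∘ suc ∘ (_↑ˡ n)) + ∑ (allFin n) (f ∘ (suc m ↑ʳ_)))
    ≡⟨ +-assoc (f zero) _ _ ⟨
  f zero + ∑ (allFin m) (f ∘ suc ∘ (_↑ˡ n)) + ∑ (allFin n) (f ∘ (suc m ↑ʳ_))
    ≡⟨ cong (_+ ∑ (allFin n) (f ∘ (suc m ↑ʳ_))) (∑-allFin-suc m (f ∘ (_↑ˡ n))) ⟨
  ∑ (allFin (suc m)) (f ∘ (_↑ˡ n)) + ∑ (allFin n) (f ∘ (suc m ↑ʳ_)) ∎
  where open ≡-Reasoning

∑-allFin-* : ∀ m n f →
  ∑ (allFin (m * n)) f ≡ ∑ (allFin m) (λ i → ∑ (allFin n) (λ j → f (combine i j)))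
∑-allFin-* zero    n f = refl
∑-allFin-* (suc m) n f = begin
  ∑ (allFin (n + m * n)) f
    ≡⟨ ∑-allFin-+ n (m * n) f ⟩
  ∑ (allFin n) (f ∘ (_↑ˡ (m * n))) + ∑ (allFin (m * n)) (f ∘ (n ↑ʳ_))
    ≡⟨ cong (λ z → ∑ (allFin n) (f ∘ (_↑ˡ (m * n))) + z) (∑-allFin-* m n (f ∘ (n ↑ʳ_))) ⟩
  ∑ (allFin n) (f ∘ (_↑ˡ (m * n))) + ∑ (allFin m) (λ i → ∑ (allFin n) (λ j → f (n ↑ʳ combine i j)))
    ≡⟨ ∑-allFin-suc m (λ i → ∑ (allFin n) (λ j → f (combine i j))) ⟨
  ∑ (allFin (suc m)) (λ i → ∑ (allFin n) (λ j → f (combine i j))) ∎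
  where open ≡-Reasoning

functions : ∀ m n → List (Fin m → Fin n)
functions m n = map (finToFun {n} {m}) (allFin (n ^ m))

∑-functions-suc : ∀ {n} m (F : (Fin (suc m) → Fin n) → ℕ) → (∀ {φ ψ} → φ ≗ ψ → F φ ≡ F ψ) →
  ∑ (functions (suc m) n) F ≡ ∑ (allFin n) (λ x → ∑ (functions m n) (λ φ → F (x Vector.∷ φ)))
∑-functions-suc {n} m F F-ext = begin
  ∑ (functions (suc m) n) F
    ≡⟨ ∑-map finToFun (allFin (n ^ suc m)) F ⟩
  ∑ (allFin (n * n ^ m)) (F ∘ finToFun)
    ≡⟨ ∑-allFin-* n (n ^ m) (F ∘ finToFun) ⟩
  ∑ (allFin n) (λ x → ∑ (allFin (n ^ m)) (λ k → F (finToFun (combine x k))))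
    ≡⟨ ∑-cong (allFin n) (λ x → ∑-cong (allFin (n ^ m)) (λ k → F-ext (finToFun-combine x k))) ⟩
  ∑ (allFin n) (λ x → ∑ (allFin (n ^ m)) (λ k → F (x Vector.∷ finToFun k)))
    ≡⟨ ∑-cong (allFin n) (λ x → ∑-map finToFun (allFin (n ^ m)) (λ φ → F (x Vector.∷ φ))) ⟨
  ∑ (allFin n) (λ x → ∑ (functions m n) (λ φ → F (x Vector.∷ φ))) ∎
  where
  open ≡-Reasoning
  finToFun-combine : ∀ x (k : Fin (n ^ m)) → finToFun {n} {suc m} (combine x k) ≗ (x Vector.∷ finToFun k)
  finToFun-combine x k zero    = cong proj₁ (remQuot-combine x k)
  finToFun-combine x k (suc i) = cong (λ qr → finToFun (proj₂ qr) i) (remQuot-combine {n} x k)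

length-filter : ∀ {A : Set} {P : A → Set} (P? : Decidable P) xs →
  length (filter P? xs) ≡ ∑ xs (λ x → ind (does (P? x)))
length-filter P? []       = refl
length-filter P? (x ∷ xs) with does (P? x)
... | true  = cong suc (length-filter P? xs)
... | false = length-filter P? xs

does-⇔ : ∀ {P : Set} (P? : Dec P) b → (P → T b) → (T b → P) → does P? ≡ b
does-⇔ (yes p) true  _ _ = refl
does-⇔ (yes p) false f _ = ⊥-elim (f p)
does-⇔ (no ¬p) true  _ g = ⊥-elim (¬p (g tt))
does-⇔ (no ¬p) false _ _ = refl

ind-∧ : ∀ b c → ind (b ∧ c) ≡ ind b * ind c
ind-∧ false c = refl
ind-∧ true  c = sym (+-identityʳ (ind c))

module _ (G : Graph) where

  bidirected : Fin (∣V∣ G) → Fin (∣V∣ G) → Bool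
  bidirected u v = edge G u v ∧ edge G v u

  bidirected-sym : ∀ u v → bidirected u v ≡ bidirected v u
  bidirected-sym u v = ∧-comm (edge G u v) (edge G v u)

  open Walks (allFin (∣V∣ G)) bidirected

  isWalk : ∀ m → (Fin (suc m) → Fin (∣V∣ G)) → Bool
  isWalk zero    φ = true
  isWalk (suc m) φ = bidirected (φ zero) (φ (suc zero)) ∧ isWalk m (φ ∘ suc)

  isWalk-ext : ∀ m {φ ψ} → φ ≗ ψ → isWalk m φ ≡ isWalk m ψ
  isWalk-ext zero    φ≗ψ = refl
  isWalk-ext (suc m) φ≗ψ =
    cong₂ _∧_ (cong₂ bidirected (φ≗ψ zero) (φ≗ψ (suc zero))) (isWalk-ext m (φ≗ψ ∘ suc))

  IsHom⇒isWalk : ∀ m φ → IsHom (P (suc m)) G φ → T (isWalk m φ)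
  IsHom⇒isWalk zero    φ hom = tt
  IsHom⇒isWalk (suc m) φ hom = from T-∧
    ( from T-∧ (hom zero (suc zero) tt , hom (suc zero) zero tt)
    , IsHom⇒isWalk m (φ ∘ suc) (λ u v → hom (suc u) (suc v)))
    where open Equivalence

  isWalk⇒IsHom : ∀ m φ → T (isWalk m φ) → IsHom (P (suc m)) G φ
  isWalk⇒IsHom zero    φ walk zero zero ()
  isWalk⇒IsHom (suc m) φ walk = go
    where
    open Equivalence
    edges = to T-∧ (proj₁ (to (T-∧ {bidirected (φ zero) (φ (suc zero))}) walk))
    tail  = isWalk⇒IsHom m (φ ∘ suc) (proj₂ (to (T-∧ {bidirected (φ zero) (φ (suc zero))}) walk))
    go : IsHom (P (suc (suc m))) G φ
    go zero          (suc zero)    _ = proj₁ edges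
    go (suc zero)    zero          _ = proj₂ edges
    go (suc u)       (suc v)       e = tail u v e

  ∑-walks : ∀ m x → ∑ (functions m (∣V∣ G)) (λ φ → ind (isWalk m (x Vector.∷ φ))) ≡ walksFrom m x
  ∑-walks zero    x = refl
  ∑-walks (suc m) x = begin
    ∑ (functions (suc m) (∣V∣ G)) (λ φ → ind (isWalk (suc m) (x Vector.∷ φ)))
      ≡⟨ ∑-functions-suc m _ (λ φ≗ψ → cong ind (isWalk-ext (suc m) (∷-cong φ≗ψ))) ⟩
    ∑ V (λ y → ∑ (functions m (∣V∣ G)) (λ φ → ind (bidirected x y ∧ isWalk m (y Vector.∷ φ))))
      ≡⟨ ∑-cong V (λ y → ∑-cong (functions m (∣V∣ G)) (λ φ → ind-∧ (bidirected x y) _)) ⟩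
    ∑ V (λ y → ∑ (functions m (∣V∣ G)) (λ φ → α x y * ind (isWalk m (y Vector.∷ φ))))
      ≡⟨ ∑-cong V (λ y → *-∑ (α x y) (functions m (∣V∣ G)) _) ⟨
    ∑ V (λ y → α x y * ∑ (functions m (∣V∣ G)) (λ φ → ind (isWalk m (y Vector.∷ φ))))
      ≡⟨ ∑-cong V (λ y → cong (α x y *_) (∑-walks m y)) ⟩
    walksFrom (suc m) x ∎
    where
    open ≡-Reasoning
    V = allFin (∣V∣ G)
    ∷-cong : ∀ {φ ψ : Fin (suc m) → Fin (∣V∣ G)} → φ ≗ ψ → (x Vector.∷ φ) ≗ (x Vector.∷ ψ)
    ∷-cong φ≗ψ zero    = refl
    ∷-cong φ≗ψ (suc i) = φ≗ψ i

  hom-path : ∀ m → hom (P (suc m)) G ≡ walks m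
  hom-path m = begin
    hom (P (suc m)) G
      ≡⟨ length-filter (isHom? (P (suc m)) G) maps ⟩
    ∑ maps (λ φ → ind (does (isHom? (P (suc m)) G φ)))
      ≡⟨ ∑-cong maps (λ φ → cong ind
           (does-⇔ (isHom? (P (suc m)) G φ) (isWalk m φ) (IsHom⇒isWalk m φ) (isWalk⇒IsHom m φ))) ⟩
    ∑ (functions (suc m) (∣V∣ G)) (λ φ → ind (isWalk m φ))
      ≡⟨ ∑-functions-suc m _ (λ φ≗ψ → cong ind (isWalk-ext m φ≗ψ)) ⟩
    ∑ (allFin (∣V∣ G)) (λ x → ∑ (functions m (∣V∣ G)) (λ φ → ind (isWalk m (x Vector.∷ φ))))
      ≡⟨ ∑-cong (allFin (∣V∣ G)) (∑-walks m) ⟩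
    walks m ∎
    where
    open ≡-Reasoning
    maps = functions (suc m) (∣V∣ G)

-- Graphs given by a list of vertices

module _ {V : Set} (vs : List V) (adj : V → V → Bool) where

  listGraph : Graph
  listGraph = record { ∣V∣ = length vs ; edge = λ i j → adj (lookup vs i) (lookup vs j) }

  ∑-lookup : ∀ f → ∑ (allFin (length vs)) (f ∘ lookup vs) ≡ ∑ vs f
  ∑-lookup f = trans (sym (∑-map (lookup vs) (allFin (length vs)) f))
    (cong (λ us → ∑ us f) (trans (map-tabulate id (lookup vs)) (tabulate-lookup vs)))

  module _ (adj-sym : ∀ u v → adj u v ≡ adj v u) where

    walksFrom-listGraph : ∀ k i → Walks.walksFrom (allFin (length vs)) (bidirected listGraph) k i
      ≡ Walks.walksFrom vs adj k (lookup vs i)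
    walksFrom-listGraph zero    i = refl
    walksFrom-listGraph (suc k) i = trans
      (∑-cong (allFin (length vs)) (λ j → cong₂ _*_
        (cong ind (trans (cong (adj (lookup vs i) (lookup vs j) ∧_) (adj-sym (lookup vs j) (lookup vs i)))
          (∧-idem (adj (lookup vs i) (lookup vs j)))))
        (walksFrom-listGraph k j)))
      (∑-lookup (λ v → ind (adj (lookup vs i) v) * Walks.walksFrom vs adj k v))

    hom-listGraph : ∀ m → hom (P (suc m)) listGraph ≡ Walks.walks vs adj m
    hom-listGraph m = trans (hom-path listGraph m)
      (trans (∑-cong (allFin (length vs)) (walksFrom-listGraph m)) (∑-lookup (Walks.walksFrom vs adj m)))

-- The extremal graphs

∑-upTo-suc : ∀ n f → ∑ (upTo (suc n)) f ≡ f 0 + ∑ (upTo n) (f ∘ suc)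
∑-upTo-suc n f = cong (λ z → f 0 + z)
  (trans (cong (λ xs → ∑ xs f) (sym (map-upTo suc n))) (∑-map suc (upTo n) f))

∑-upTo-≤ : ∀ n (f : ℕ → ℕ) {M} → (∀ i → i < n → f i ≤ M) → ∑ (upTo n) f ≤ n * M
∑-upTo-≤ zero    f     f≤M = z≤n
∑-upTo-≤ (suc n) f {M} f≤M = subst (_≤ suc n * M) (sym (∑-upTo-suc n f))
  (+-mono-≤ (f≤M 0 z<s) (∑-upTo-≤ n (f ∘ suc) (λ i i<n → f≤M (suc i) (s<s i<n))))

∑-upTo-≥ : ∀ n (f : ℕ → ℕ) {M} → (∀ i → i < n → M ≤ f i) → n * M ≤ ∑ (upTo n) f
∑-upTo-≥ zero    f     M≤f = z≤n
∑-upTo-≥ (suc n) f {M} M≤f = subst (suc n * M ≤_) (sym (∑-upTo-suc n f))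
  (+-mono-≤ (M≤f 0 z<s) (∑-upTo-≥ n (f ∘ suc) (λ i i<n → M≤f (suc i) (s<s i<n))))

term≤∑-upTo : ∀ n f {i} → i < n → f i ≤ ∑ (upTo n) f
term≤∑-upTo (suc n) f {zero}  _         = subst (f 0 ≤_) (sym (∑-upTo-suc n f)) (m≤m+n (f 0) (∑ (upTo n) (f ∘ suc)))
term≤∑-upTo (suc n) f {suc i} (s<s i<n) = subst (f (suc i) ≤_) (sym (∑-upTo-suc n f))
  (≤-trans (term≤∑-upTo n (f ∘ suc) i<n) (m≤n+m (∑ (upTo n) (f ∘ suc)) (f 0)))

-- For sums over neighbours: adjacency determines the block, and sometimes the colour, of a
-- neighbour.
∑-upTo-unique : ∀ n (f : ℕ → ℕ) {M} (p : ℕ → Bool) →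
  (∀ i j → T (p i) → T (p j) → i ≡ j) → (∀ i → T (p i) → f i ≤ M) →
  ∑ (upTo n) (λ i → ind (p i) * f i) ≤ M
∑-upTo-unique zero    f     p unique f≤M = z≤n
∑-upTo-unique (suc n) f {M} p unique f≤M =
  subst (_≤ M) (sym (∑-upTo-suc n (λ i → ind (p i) * f i))) step
  where
  none : T (p 0) → ∀ i → ind (p (suc i)) * f (suc i) ≡ 0
  none p0 i with p (suc i) | unique 0 (suc i) p0
  ... | false | _  = refl
  ... | true  | eq with () ← eq tt
  step : ind (p 0) * f 0 + ∑ (upTo n) (λ i → ind (p (suc i)) * f (suc i)) ≤ M
  step with p 0 | none | f≤M 0
  ... | true  | none | f0≤M = subst (_≤ M)
    (sym (trans (cong (λ z → 1 * f 0 + z) (trans (∑-cong (upTo n) (none tt)) (∑-0 (upTo n)))) (eq (f 0)))) (f0≤M tt)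
    where
    eq : ∀ x → 1 * x + 0 ≡ x
    eq = solve-∀
  ... | false | _    | _    = ∑-upTo-unique n (f ∘ suc) (p ∘ suc)
    (λ i j pi pj → suc-injective (unique (suc i) (suc j) pi pj)) (λ i → f≤M (suc i))

≡ᵇ-sym : ∀ m n → (m ≡ᵇ n) ≡ (n ≡ᵇ m)
≡ᵇ-sym zero    zero    = refl
≡ᵇ-sym zero    (suc n) = refl
≡ᵇ-sym (suc m) zero    = refl
≡ᵇ-sym (suc m) (suc n) = ≡ᵇ-sym m n

≡⇒ind : ∀ {m n} → m ≡ n → ind (m ≡ᵇ n) ≡ 1
≡⇒ind {zero}  refl = refl
≡⇒ind {suc m} refl = ≡⇒ind {m} refl

-- X b and Y b are blocks of k · k ^ (2b) vertices, b ≤ n resp. b < n, and c < k is a colour seen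
-- only by edges between X blocks.  The walks counted are X n, X 0, Y (n-1), Y 0, X (n-1), X 1, …,
-- X 0, X n, and the sizes k ^ (1 + 2b) are read off an optimal solution of the linear program.
data Vertex : Set where
  X Y : (b c y : ℕ) → Vertex

module Extremal (n k : ℕ) {{k≢0 : NonZero k}} where

  open ≤-Reasoning

  q : ℕ
  q = k * k

  instance
    q≢0 : NonZero q
    q≢0 = m*n≢0 k k

  -- Matching colours divides the degree between opposite X blocks by `k`. This balances the blocks:
  -- each contributes to `walks 3` at most a constant times `k * (q ^ n * q ^ n)`.
  adj : Vertex → Vertex → Bool
  adj (X b c _) (X b′ c′ _) = (b + b′ ≡ᵇ n) ∧ (c ≡ᵇ c′)
  adj (X b _ _) (Y b′ _  _) = suc (b + b′) ≡ᵇ n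
  adj (Y b _ _) (X b′ _  _) = suc (b + b′) ≡ᵇ n
  adj (Y b _ _) (Y b′ _  _) = suc (b + b′) ≡ᵇ n

  adj-sym : ∀ u v → adj u v ≡ adj v u
  adj-sym (X b c _) (X b′ c′ _) = cong₂ _∧_ (cong (_≡ᵇ n) (+-comm b b′)) (≡ᵇ-sym c c′)
  adj-sym (X b _ _) (Y b′ _  _) = cong (λ m → suc m ≡ᵇ n) (+-comm b b′)
  adj-sym (Y b _ _) (X b′ _  _) = cong (λ m → suc m ≡ᵇ n) (+-comm b b′)
  adj-sym (Y b _ _) (Y b′ _  _) = cong (λ m → suc m ≡ᵇ n) (+-comm b b′)

  block : (ℕ → ℕ → ℕ → Vertex) → ℕ → List Vertex
  block K b = concatMap (λ c → map (K b c) (upTo (q ^ b))) (upTo k)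

  vertices : List Vertex
  vertices = concatMap (block X) (upTo (suc n)) ++ concatMap (block Y) (upTo n)

  ∑-block : ∀ K b f → ∑ (block K b) f ≡ ∑ (upTo k) (λ c → ∑ (upTo (q ^ b)) (λ y → f (K b c y)))
  ∑-block K b f = trans (∑-concatMap _ (upTo k) f) (∑-cong (upTo k) (λ c → ∑-map (K b c) (upTo (q ^ b)) f))

  ∑-vertices : ∀ f → ∑ vertices f
    ≡ ∑ (upTo (suc n)) (λ b → ∑ (block X b) f) + ∑ (upTo n) (λ b → ∑ (block Y b) f)
  ∑-vertices f = trans (∑-++ (concatMap (block X) (upTo (suc n))) _ f)
    (cong₂ _+_ (∑-concatMap (block X) (upTo (suc n)) f) (∑-concatMap (block Y) (upTo n) f))

  ∑-block-≤ : ∀ K b f {M} → (∀ c y → f (K b c y) ≤ M) → ∑ (block K b) f ≤ k * q ^ b * M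
  ∑-block-≤ K b f {M} f≤M = begin
    ∑ (block K b) f                                          ≡⟨ ∑-block K b f ⟩
    ∑ (upTo k) (λ c → ∑ (upTo (q ^ b)) (λ y → f (K b c y)))
      ≤⟨ ∑-upTo-≤ k _ (λ c _ → ∑-upTo-≤ (q ^ b) (λ y → f (K b c y)) (λ y _ → f≤M c y)) ⟩
    k * (q ^ b * M)                                          ≡⟨ *-assoc k (q ^ b) M ⟨
    k * q ^ b * M                                            ∎

  ∑-block-≥ : ∀ K b f {M} → (∀ c y → c < k → M ≤ f (K b c y)) → k * q ^ b * M ≤ ∑ (block K b) f
  ∑-block-≥ K b f {M} M≤f = begin
    k * q ^ b * M                                            ≡⟨ *-assoc k (q ^ b) M ⟩
    k * (q ^ b * M)
      ≤⟨ ∑-upTo-≥ k _ (λ c c<k → ∑-upTo-≥ (q ^ b) (λ y → f (K b c y)) (λ y _ → M≤f c y c<k)) ⟩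
    ∑ (upTo k) (λ c → ∑ (upTo (q ^ b)) (λ y → f (K b c y)))  ≡⟨ ∑-block K b f ⟨
    ∑ (block K b) f                                          ∎

  X-block≤∑ : ∀ {b} f → b ≤ n → ∑ (block X b) f ≤ ∑ vertices f
  X-block≤∑ {b} f b≤n = begin
    ∑ (block X b) f                                  ≤⟨ term≤∑-upTo (suc n) (λ b → ∑ (block X b) f) (s<s b≤n) ⟩
    ∑ (upTo (suc n)) (λ b → ∑ (block X b) f)         ≤⟨ m≤m+n _ _ ⟩
    ∑ (upTo (suc n)) (λ b → ∑ (block X b) f) + ∑ (upTo n) (λ b → ∑ (block Y b) f) ≡⟨ ∑-vertices f ⟨
    ∑ vertices f                                     ∎

  Y-block≤∑ : ∀ {b} f → b < n → ∑ (block Y b) f ≤ ∑ vertices f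
  Y-block≤∑ {b} f b<n = begin
    ∑ (block Y b) f                                  ≤⟨ term≤∑-upTo n (λ b → ∑ (block Y b) f) b<n ⟩
    ∑ (upTo n) (λ b → ∑ (block Y b) f)               ≤⟨ m≤n+m _ _ ⟩
    ∑ (upTo (suc n)) (λ b → ∑ (block X b) f) + ∑ (upTo n) (λ b → ∑ (block Y b) f) ≡⟨ ∑-vertices f ⟨
    ∑ vertices f                                     ∎

  open Walks vertices adj
  open Symmetric adj-sym using (walks-+)

  adjacent-sum-≤ : ∀ v N K m (f : Vertex → ℕ) (F : ℕ → ℕ) {M} → (∀ b c y → f (K b c y) ≤ F b) →
    (∀ b c y → adj v (K b c y) ≡ (m + b ≡ᵇ n)) →
    (∀ b → m + b ≡ n → k * q ^ b * F b ≤ M) →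
    ∑ (upTo N) (λ b → ∑ (block K b) (λ u → α v u * f u)) ≤ M
  adjacent-sum-≤ v N K m f F {M} f≤F adj≡ bound = begin
    ∑ (upTo N) (λ b → ∑ (block K b) (λ u → α v u * f u))
      ≤⟨ ∑-mono-≤ (upTo N) (λ b → ∑-block-≤ K b (λ u → α v u * f u) (λ c y → *-mono-≤
           (≤-reflexive (cong ind (adj≡ b c y))) (f≤F b c y))) ⟩
    ∑ (upTo N) (λ b → k * q ^ b * (ind (m + b ≡ᵇ n) * F b))
      ≡⟨ ∑-cong (upTo N) (λ b → swap (k * q ^ b) (ind (m + b ≡ᵇ n)) (F b)) ⟩
    ∑ (upTo N) (λ b → ind (m + b ≡ᵇ n) * (k * q ^ b * F b))
      ≤⟨ ∑-upTo-unique N (λ b → k * q ^ b * F b) (λ b → m + b ≡ᵇ n)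
           (λ i j pi pj → +-cancelˡ-≡ m i j (trans (≡ᵇ⇒≡ (m + i) n pi) (sym (≡ᵇ⇒≡ (m + j) n pj))))
           (λ b pb → bound b (≡ᵇ⇒≡ (m + b) n pb)) ⟩
    M ∎
    where
    swap : ∀ a b c → a * (b * c) ≡ b * (a * c)
    swap = solve-∀

  -- As in `adjacent-sum-≤` one block remains, but here also just one colour, which saves the factor
  -- `k` in the bound.
  coloured-sum-≤ : ∀ b c y (f : Vertex → ℕ) (F : ℕ → ℕ) {M} → (∀ b c y → f (X b c y) ≤ F b) →
    (∀ b′ → b + b′ ≡ n → q ^ b′ * F b′ ≤ M) →
    ∑ (upTo (suc n)) (λ b′ → ∑ (block X b′) (λ u → α (X b c y) u * f u)) ≤ M
  coloured-sum-≤ b c y f F {M} f≤F bound = begin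
    ∑ (upTo (suc n)) (λ b′ → ∑ (block X b′) (λ u → α (X b c y) u * f u))
      ≡⟨ ∑-cong (upTo (suc n)) (λ b′ → ∑-block X b′ (λ u → α (X b c y) u * f u)) ⟩
    ∑ (upTo (suc n)) (λ b′ → ∑ (upTo k) (λ c′ → ∑ (upTo (q ^ b′)) (λ y′ →
      ind ((b + b′ ≡ᵇ n) ∧ (c ≡ᵇ c′)) * f (X b′ c′ y′))))
      ≤⟨ ∑-mono-≤ (upTo (suc n)) (λ b′ → ∑-mono-≤ (upTo k) (λ c′ → ∑-upTo-≤ (q ^ b′) _ (λ y′ _ →
           *-mono-≤ (≤-reflexive (ind-∧ (b + b′ ≡ᵇ n) (c ≡ᵇ c′))) (f≤F b′ c′ y′)))) ⟩
    ∑ (upTo (suc n)) (λ b′ → ∑ (upTo k) (λ c′ → q ^ b′ * (ind (b + b′ ≡ᵇ n) * ind (c ≡ᵇ c′) * F b′)))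
      ≡⟨ ∑-cong (upTo (suc n)) (λ b′ → trans
           (∑-cong (upTo k) (λ c′ → swap (q ^ b′) (ind (b + b′ ≡ᵇ n)) (ind (c ≡ᵇ c′)) (F b′)))
           (sym (*-∑ (ind (b + b′ ≡ᵇ n)) (upTo k) _))) ⟩
    ∑ (upTo (suc n)) (λ b′ → ind (b + b′ ≡ᵇ n) * ∑ (upTo k) (λ c′ → ind (c ≡ᵇ c′) * (q ^ b′ * F b′)))
      ≤⟨ ∑-upTo-unique (suc n) _ (λ b′ → b + b′ ≡ᵇ n)
           (λ i j pi pj → +-cancelˡ-≡ b i j (trans (≡ᵇ⇒≡ (b + i) n pi) (sym (≡ᵇ⇒≡ (b + j) n pj))))
           (λ b′ pb′ → ∑-upTo-unique k (λ _ → q ^ b′ * F b′) (c ≡ᵇ_)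
             (λ i j pi pj → trans (sym (≡ᵇ⇒≡ c i pi)) (≡ᵇ⇒≡ c j pj))
             (λ _ _ → bound b′ (≡ᵇ⇒≡ (b + b′) n pb′))) ⟩
    M ∎
    where
    swap : ∀ a b c d → a * (b * c * d) ≡ b * (c * (a * d))
    swap = solve-∀

  -- The `2` allows for one neighbouring X block and one neighbouring Y block.
  δX δY : ℕ → ℕ
  δX b = 2 * q ^ (n ∸ b)
  δY b = 2 * (k * q ^ (n ∸ suc b))

  walksFrom-X-≤ : ∀ m b c y (F G : ℕ → ℕ) {M} →
    (∀ b c y → walksFrom m (X b c y) ≤ F b) → (∀ b c y → walksFrom m (Y b c y) ≤ G b) →
    (∀ b′ → b + b′ ≡ n → q ^ b′ * F b′ ≤ M) → (∀ b′ → suc b + b′ ≡ n → k * q ^ b′ * G b′ ≤ M) →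
    walksFrom (suc m) (X b c y) ≤ 2 * M
  walksFrom-X-≤ m b c y F G {M} s≤F s≤G F≤M G≤M = begin
    walksFrom (suc m) (X b c y)
      ≡⟨ ∑-vertices (λ u → α (X b c y) u * walksFrom m u) ⟩
    ∑ (upTo (suc n)) (λ b′ → ∑ (block X b′) (λ u → α (X b c y) u * walksFrom m u))
      + ∑ (upTo n) (λ b′ → ∑ (block Y b′) (λ u → α (X b c y) u * walksFrom m u))
      ≤⟨ +-mono-≤ (coloured-sum-≤ b c y (walksFrom m) F s≤F F≤M)
                                      (adjacent-sum-≤ (X b c y) n Y (suc b) (walksFrom m) G s≤G (λ _ _ _ → refl) G≤M) ⟩
    M + M
      ≡⟨ cong (λ z → M + z) (+-identityʳ M) ⟨
    2 * M ∎

  walksFrom-Y-≤ : ∀ m b c y (F G : ℕ → ℕ) {M} →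
    (∀ b c y → walksFrom m (X b c y) ≤ F b) → (∀ b c y → walksFrom m (Y b c y) ≤ G b) →
    (∀ b′ → suc b + b′ ≡ n → k * q ^ b′ * F b′ ≤ M) → (∀ b′ → suc b + b′ ≡ n → k * q ^ b′ * G b′ ≤ M) →
    walksFrom (suc m) (Y b c y) ≤ 2 * M
  walksFrom-Y-≤ m b c y F G {M} s≤F s≤G F≤M G≤M = begin
    walksFrom (suc m) (Y b c y)
      ≡⟨ ∑-vertices (λ u → α (Y b c y) u * walksFrom m u) ⟩
    ∑ (upTo (suc n)) (λ b′ → ∑ (block X b′) (λ u → α (Y b c y) u * walksFrom m u))
      + ∑ (upTo n) (λ b′ → ∑ (block Y b′) (λ u → α (Y b c y) u * walksFrom m u))
      ≤⟨ +-mono-≤ (adjacent-sum-≤ (Y b c y) (suc n) X (suc b) (walksFrom m) F s≤F (λ _ _ _ → refl) F≤M)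
                                      (adjacent-sum-≤ (Y b c y) n Y (suc b) (walksFrom m) G s≤G (λ _ _ _ → refl) G≤M) ⟩
    M + M
      ≡⟨ cong (λ z → M + z) (+-identityʳ M) ⟨
    2 * M ∎

  k*q^≤q^suc : ∀ b → k * q ^ b ≤ q ^ suc b
  k*q^≤q^suc b = *-monoˡ-≤ (q ^ b) (m≤m*n k k)

  complement : ∀ a b → a + b ≡ n → n ∸ a ≡ b
  complement a b refl = m+n∸m≡n a b

  degree-X : ∀ b c y → walksFrom 1 (X b c y) ≤ δX b
  degree-X b c y = walksFrom-X-≤ 0 b c y (λ _ → 1) (λ _ → 1) (λ _ _ _ → ≤-refl) (λ _ _ _ → ≤-refl)
    (λ b′ eq → ≤-reflexive (trans (*-identityʳ (q ^ b′)) (cong (q ^_) (sym (complement b b′ eq)))))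
    (λ b′ eq → begin
      k * q ^ b′ * 1  ≡⟨ *-identityʳ (k * q ^ b′) ⟩
      k * q ^ b′      ≤⟨ k*q^≤q^suc b′ ⟩
      q ^ suc b′      ≡⟨ cong (q ^_) (complement b (suc b′) (trans (+-suc b b′) eq)) ⟨
      q ^ (n ∸ b)     ∎)

  degree-Y : ∀ b c y → walksFrom 1 (Y b c y) ≤ δY b
  degree-Y b c y = walksFrom-Y-≤ 0 b c y (λ _ → 1) (λ _ → 1) (λ _ _ _ → ≤-refl) (λ _ _ _ → ≤-refl)
    bound bound
    where
    bound : ∀ b′ → suc b + b′ ≡ n → k * q ^ b′ * 1 ≤ k * q ^ (n ∸ suc b)
    bound b′ eq = ≤-reflexive (trans (*-identityʳ (k * q ^ b′)) (cong (λ e → k * q ^ e) (sym (complement (suc b) b′ eq))))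

  q^-∸ : ∀ {b} → b ≤ n → q ^ b * q ^ (n ∸ b) ≡ q ^ n
  q^-∸ {b} b≤n = trans (sym (^-distribˡ-+-* q b (n ∸ b))) (cong (q ^_) (m+[n∸m]≡n b≤n))

  q^bδX : ∀ {b} → b ≤ n → q ^ b * δX b ≡ 2 * q ^ n
  q^bδX {b} b≤n = trans (swap (q ^ b) 2 (q ^ (n ∸ b))) (cong (2 *_) (q^-∸ b≤n))
    where
    swap : ∀ a b c → a * (b * c) ≡ b * (a * c)
    swap = solve-∀

  kq^bδY : ∀ {b} → suc b ≤ n → k * q ^ b * δY b ≡ 2 * q ^ n
  kq^bδY {b} b<n = trans (swap k (q ^ b) (q ^ (n ∸ suc b))) (cong (2 *_) (q^-∸ b<n))
    where
    swap : ∀ k b c → k * b * (2 * (k * c)) ≡ 2 * (k * k * b * c)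
    swap = solve-∀

  right≤n : ∀ m {b} → m + b ≡ n → b ≤ n
  right≤n m refl = m≤n+m _ m

  walks2-X : ∀ b c y → walksFrom 2 (X b c y) ≤ 4 * q ^ n
  walks2-X b c y = subst (walksFrom 2 (X b c y) ≤_) (sym (*-assoc 2 2 (q ^ n)))
    (walksFrom-X-≤ 1 b c y δX δY degree-X degree-Y
      (λ b′ eq → ≤-reflexive (q^bδX (right≤n b eq)))
      (λ b′ eq → ≤-reflexive (kq^bδY (right≤n b (trans (+-suc b b′) eq)))))

  walks2-Y : ∀ b c y → walksFrom 2 (Y b c y) ≤ 4 * (k * q ^ n)
  walks2-Y b c y = subst (walksFrom 2 (Y b c y) ≤_) (sym (*-assoc 2 2 (k * q ^ n)))
    (walksFrom-Y-≤ 1 b c y δX δY degree-X degree-Y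
      (λ b′ eq → ≤-reflexive (begin-equality
        k * q ^ b′ * δX b′    ≡⟨ *-assoc k (q ^ b′) (δX b′) ⟩
        k * (q ^ b′ * δX b′)  ≡⟨ cong (k *_) (q^bδX (right≤n (suc b) eq)) ⟩
        k * (2 * q ^ n)       ≡⟨ swap k (q ^ n) ⟩
        2 * (k * q ^ n)       ∎))
      (λ b′ eq → begin
        k * q ^ b′ * δY b′    ≡⟨ kq^bδY (right≤n b (trans (+-suc b b′) eq)) ⟩
        2 * q ^ n             ≤⟨ *-monoʳ-≤ 2 (m≤n*m (q ^ n) k) ⟩
        2 * (k * q ^ n)       ∎))
    where
    swap : ∀ k a → k * (2 * a) ≡ 2 * (k * a)
    swap = solve-∀

  q^≡ : ∀ m → q ^ m ≡ k ^ (2 * m)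
  q^≡ m = trans (cong (λ z → (k * z) ^ m) (sym (*-identityʳ k))) (^-*-assoc k 2 m)

  -- Splitting at the second vertex, each of the `suc n` X blocks and `n` Y blocks contributes at
  -- most `8 * (k * (q ^ n * q ^ n))`: a 2 from the degree and a 4 from the walks of length two.
  walks3-≤ : walks 3 ≤ (suc n + n) * 8 * k ^ (4 * n + 1)
  walks3-≤ = begin
    walks 3
      ≡⟨ walks-+ 1 2 ⟨
    ∑ vertices (λ v → walksFrom 1 v * walksFrom 2 v)
      ≡⟨ ∑-vertices (λ v → walksFrom 1 v * walksFrom 2 v) ⟩
    ∑ (upTo (suc n)) (λ b → ∑ (block X b) (λ v → walksFrom 1 v * walksFrom 2 v))
      + ∑ (upTo n) (λ b → ∑ (block Y b) (λ v → walksFrom 1 v * walksFrom 2 v))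
      ≤⟨ +-mono-≤
        (∑-upTo-≤ (suc n) _ (λ b b<1+n → begin
          ∑ (block X b) (λ v → walksFrom 1 v * walksFrom 2 v)
            ≤⟨ ∑-block-≤ X b _ (λ c y → *-mono-≤ (degree-X b c y) (walks2-X b c y)) ⟩
          k * q ^ b * (δX b * (4 * q ^ n))
            ≡⟨ eq₁ k (q ^ b) (δX b) (q ^ n) ⟩
          4 * (k * (q ^ b * δX b * q ^ n))
            ≡⟨ cong (λ z → 4 * (k * (z * q ^ n))) (q^bδX (s≤s⁻¹ b<1+n)) ⟩
          4 * (k * (2 * q ^ n * q ^ n)) ∎))
        (∑-upTo-≤ n _ (λ b b<n → begin
          ∑ (block Y b) (λ v → walksFrom 1 v * walksFrom 2 v)
            ≤⟨ ∑-block-≤ Y b _ (λ c y → *-mono-≤ (degree-Y b c y) (walks2-Y b c y)) ⟩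
          k * q ^ b * (δY b * (4 * (k * q ^ n)))
            ≡⟨ eq₂ k (k * q ^ b) (δY b) (q ^ n) ⟩
          4 * (k * (k * q ^ b * δY b * q ^ n))
            ≡⟨ cong (λ z → 4 * (k * (z * q ^ n))) (kq^bδY b<n) ⟩
          4 * (k * (2 * q ^ n * q ^ n)) ∎)) ⟩
    suc n * (4 * (k * (2 * q ^ n * q ^ n))) + n * (4 * (k * (2 * q ^ n * q ^ n)))
      ≡⟨ eq₃ n k (q ^ n) ⟩
    (suc n + n) * 8 * (k * (q ^ n * q ^ n))
      ≡⟨ cong (λ z → (suc n + n) * 8 * (k * (z * z))) (q^≡ n) ⟩
    (suc n + n) * 8 * (k * (k ^ (2 * n) * k ^ (2 * n)))
      ≡⟨ cong (λ z → (suc n + n) * 8 * (k * z)) (^-distribˡ-+-* k (2 * n) (2 * n)) ⟨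
    (suc n + n) * 8 * k ^ suc (2 * n + 2 * n)
      ≡⟨ cong (λ e → (suc n + n) * 8 * k ^ e) (eq₄ n) ⟩
    (suc n + n) * 8 * k ^ (4 * n + 1) ∎
    where
    eq₁ : ∀ k a d c → k * a * (d * (4 * c)) ≡ 4 * (k * (a * d * c))
    eq₁ = solve-∀
    eq₂ : ∀ k a d c → a * (d * (4 * (k * c))) ≡ 4 * (k * (a * d * c))
    eq₂ = solve-∀
    eq₃ : ∀ n k c → suc n * (4 * (k * (2 * c * c))) + n * (4 * (k * (2 * c * c))) ≡ (suc n + n) * 8 * (k * (c * c))
    eq₃ = solve-∀
    eq₄ : ∀ n → suc (2 * n + 2 * n) ≡ 4 * n + 1
    eq₄ = solve-∀

  block-step : ∀ m v K b {M} → (∀ f → ∑ (block K b) f ≤ ∑ vertices f) →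
    (∀ c y → α v (K b c y) ≡ 1) → (∀ c y → c < k → M ≤ walksFrom m (K b c y)) →
    k * q ^ b * M ≤ walksFrom (suc m) v
  block-step m v K b {M} block≤ α≡1 M≤s = ≤-trans
    (∑-block-≥ K b (λ u → α v u * walksFrom m u) (λ c y c<k → begin
      M                                     ≤⟨ M≤s c y c<k ⟩
      walksFrom m (K b c y)                 ≡⟨ *-identityˡ (walksFrom m (K b c y)) ⟨
      1 * walksFrom m (K b c y)             ≡⟨ cong (_* walksFrom m (K b c y)) (α≡1 c y) ⟨
      α v (K b c y) * walksFrom m (K b c y) ∎))
    (block≤ (λ u → α v u * walksFrom m u))

  coloured-step : ∀ m {b b′} c y {M} → b + b′ ≡ n → c < k →
    (∀ y → M ≤ walksFrom m (X b′ c y)) → q ^ b′ * M ≤ walksFrom (suc m) (X b c y)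
  coloured-step m {b} {b′} c y {M} eq c<k M≤s = begin
    q ^ b′ * M
      ≤⟨ ∑-upTo-≥ (q ^ b′) (λ y′ → f (X b′ c y′)) (λ y′ _ → begin
        M                                       ≤⟨ M≤s y′ ⟩
        walksFrom m (X b′ c y′)                 ≡⟨ *-identityˡ (walksFrom m (X b′ c y′)) ⟨
        1 * walksFrom m (X b′ c y′)             ≡⟨ cong (_* walksFrom m (X b′ c y′)) (trans
          (ind-∧ (b + b′ ≡ᵇ n) (c ≡ᵇ c)) (cong₂ _*_ (≡⇒ind eq) (≡⇒ind {c} refl))) ⟨
        f (X b′ c y′) ∎) ⟩
    ∑ (upTo (q ^ b′)) (λ y′ → f (X b′ c y′))
      ≤⟨ term≤∑-upTo k (λ c → ∑ (upTo (q ^ b′)) (λ y′ → f (X b′ c y′))) c<k ⟩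
    ∑ (upTo k) (λ c → ∑ (upTo (q ^ b′)) (λ y′ → f (X b′ c y′)))
      ≡⟨ ∑-block X b′ f ⟨
    ∑ (block X b′) f
      ≤⟨ X-block≤∑ f (right≤n b eq) ⟩
    walksFrom (suc m) (X b c y) ∎
    where
    f : Vertex → ℕ
    f u = α (X b c y) u * walksFrom m u

  -- One period X (1 + b), X b′, Y b, Y b′, X b of the walk multiplies the count by this.
  period : ℕ
  period = k * (q ^ n * q ^ pred n)

  -- Only walks along the prescribed blocks are counted. The four steps of a period offer `q ^ b′`,
  -- `k * q ^ a`, `k * q ^ b′` and `k * q ^ a` choices; as `a + b′` is `n - 1`, their product does
  -- not depend on `a`.
  walksFrom-X-≥ : ∀ b b′ c y → b + b′ ≡ n → c < k → q ^ n * period ^ b ≤ walksFrom (1 + b * 4) (X b c y)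
  walksFrom-X-≥ zero b′ c y eq c<k = subst
    (λ e → q ^ e * 1 ≤ walksFrom 1 (X 0 c y)) eq (coloured-step 0 {0} {b′} c y eq c<k (λ _ → ≤-refl))
  walksFrom-X-≥ (suc a) b′ c y eq c<k = begin
    q ^ n * (period * period ^ a)
      ≡⟨ eq₁ (q ^ n) k (q ^ pred n) (period ^ a) ⟩
    k * (q ^ n * q ^ pred n) * rest
      ≡⟨ cong (λ z → k * (z * q ^ pred n) * rest) (cong (q ^_) eq) ⟨
    k * (q * q ^ (a + b′) * q ^ pred n) * rest
      ≡⟨ cong (λ e → k * (q * q ^ (a + b′) * q ^ e) * rest) (cong pred eq) ⟨
    k * (q * q ^ (a + b′) * q ^ (a + b′)) * rest
      ≡⟨ cong (λ z → k * (q * z * z) * rest) (^-distribˡ-+-* q a b′) ⟩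
    k * (q * (q ^ a * q ^ b′) * (q ^ a * q ^ b′)) * rest
      ≡⟨ eq₂ k (q ^ a) (q ^ b′) rest ⟩
    q ^ b′ * (k * q ^ a * (k * q ^ b′ * (k * q ^ a * rest)))
      ≤⟨ coloured-step (4 + a * 4) {suc a} {b′} c y eq c<k (λ y₁ →
         block-step (3 + a * 4) (X b′ c y₁) Y a (λ f → Y-block≤∑ f a<n) (λ _ _ → ≡⇒ind eq′)
           (λ c₂ y₂ _ → block-step (2 + a * 4) (Y a c₂ y₂) Y b′ (λ f → Y-block≤∑ f b′<n) (λ _ _ → ≡⇒ind eq)
             (λ c₃ y₃ _ → block-step (1 + a * 4) (Y b′ c₃ y₃) X a (λ f → X-block≤∑ f (<⇒≤ a<n)) (λ _ _ → ≡⇒ind eq′)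
               (λ c₄ y₄ c₄<k → walksFrom-X-≥ a (suc b′) c₄ y₄ (trans (+-suc a b′) eq) c₄<k)))) ⟩
    walksFrom (5 + a * 4) (X (suc a) c y) ∎
    where
    rest = q ^ n * period ^ a
    a<n : a < n
    a<n = subst (suc a ≤_) eq (m≤m+n (suc a) b′)
    eq′ : suc (b′ + a) ≡ n
    eq′ = trans (cong suc (+-comm b′ a)) eq
    b′<n : b′ < n
    b′<n = subst (suc b′ ≤_) eq′ (m≤m+n (suc b′) a)
    eq₁ : ∀ Q k P R → Q * (k * (Q * P) * R) ≡ k * (Q * P) * (Q * R)
    eq₁ = solve-∀
    eq₂ : ∀ k a b L → k * (k * k * (a * b) * (a * b)) * L ≡ b * (k * a * (k * b * (k * a * L)))
    eq₂ = solve-∀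

  -- The exponent is `1 + 2n` for the start in `X n`, `2n` for the last step from `X 0` to `X n`,
  -- and `4n - 1` for each of the `n` periods.
  walks-≥ : ∀ m → suc m ≡ n → k ^ (1 + 3 * n + 4 * n ^ 2) ≤ walks (4 * n + 1)
  walks-≥ m refl = begin
    k ^ (1 + 3 * n + 4 * n ^ 2)
      ≡⟨ cong (k ^_) (eq₁ m) ⟩
    k ^ (1 + 2 * n + (2 * n + (1 + (2 * n + 2 * m)) * n))
      ≡⟨ ^-distribˡ-+-* k (1 + 2 * n) (2 * n + (1 + (2 * n + 2 * m)) * n) ⟩
    k * k ^ (2 * n) * k ^ (2 * n + (1 + (2 * n + 2 * m)) * n)
      ≡⟨ cong (k * k ^ (2 * n) *_) (^-distribˡ-+-* k (2 * n) ((1 + (2 * n + 2 * m)) * n)) ⟩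
    k * k ^ (2 * n) * (k ^ (2 * n) * k ^ ((1 + (2 * n + 2 * m)) * n))
      ≡⟨ cong (λ z → k * k ^ (2 * n) * (k ^ (2 * n) * z)) (^-*-assoc k (1 + (2 * n + 2 * m)) n) ⟨
    k * k ^ (2 * n) * (k ^ (2 * n) * (k * k ^ (2 * n + 2 * m)) ^ n)
      ≡⟨ cong (λ z → k * k ^ (2 * n) * (k ^ (2 * n) * (k * z) ^ n)) (^-distribˡ-+-* k (2 * n) (2 * m)) ⟩
    k * k ^ (2 * n) * (k ^ (2 * n) * (k * (k ^ (2 * n) * k ^ (2 * m))) ^ n)
      ≡⟨ cong₂ (λ u v → k * u * (u * (k * (u * v)) ^ n)) (q^≡ n) (q^≡ m) ⟨
    k * q ^ n * (q ^ n * period ^ n)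
      ≤⟨ ∑-block-≥ X n (walksFrom (1 + n * 4)) (λ c y c<k → walksFrom-X-≥ n 0 c y (+-identityʳ n) c<k) ⟩
    ∑ (block X n) (walksFrom (1 + n * 4))
      ≤⟨ X-block≤∑ (walksFrom (1 + n * 4)) ≤-refl ⟩
    walks (1 + n * 4)
      ≡⟨ cong walks (eq₂ n) ⟩
    walks (4 * n + 1) ∎
    where
    eq₁ : ∀ m → 1 + 3 * suc m + 4 * (suc m * (suc m * 1))
      ≡ 1 + 2 * suc m + (2 * suc m + (1 + (2 * suc m + 2 * m)) * suc m)
    eq₁ = solve-∀
    eq₂ : ∀ n → 1 + n * 4 ≡ 4 * n + 1
    eq₂ = solve-∀

-- The exponent as a Dedekind real

IsHom⇒1≤hom : ∀ F G φ → IsHom F G φ → 1 ≤ hom F G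
IsHom⇒1≤hom F G φ φ-hom = filter-some (isHom? F G)
  (lose (∈-map⁺ finToFun (∈-allFin (funToFin φ))) λ u v e →
    subst₂ (λ x y → T (edge G x y)) (sym (finToFun-funToFin φ u)) (sym (finToFun-funToFin φ v)) (φ-hom u v e))

P-mono : ∀ {m n} → m ≤ n → 1 ≤ hom (P m) (P n)
P-mono {m} {n} m≤n = IsHom⇒1≤hom (P m) (P n) (λ i → inject≤ i m≤n) λ u v →
  subst₂ (λ i j → T ((suc i ≡ᵇ j) ∨ (suc j ≡ᵇ i))) (sym (toℕ-inject≤ u m≤n)) (sym (toℕ-inject≤ v m≤n))

module _ (a b : ℕ) .{{_ : NonZero a}} where

  open ≤-Reasoning

  private
    d : ℕ
    d = suc b

    s : ℚ
    s = + a / d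

  0<s : 0ℚ ℚ.< s
  0<s = ℚ.positive⁻¹ s {{ℚ.normalize-pos a d}}

  -- For `r = m / e`, cross-multiplication compares `m * d` with `a * e`, and a `d`-th root
  -- finishes. A negative `r` only needs `x` positive, which the hypothesis forces.
  RatPow≤-< : ∀ y x r → suc y ^ a ≤ x ^ d → r ℚ.< s → RatPow≤ (suc y) r x
  RatPow≤-< y x (mkℚ (+ m) e-1 c) y^a≤x^d r<s
    -- `s` is stored in lowest terms; its unnormalised form restores `a` and `d` themselves.
    with *<* me<ad ← ℚᵘ.<-respʳ-≃ (ℚ.toℚᵘ-fromℚᵘ (mkℚᵘ (+ a) b)) (ℚ.toℚᵘ-mono-< r<s) = ^-cancelˡ-≤ d (begin
    (suc y ^ m) ^ d   ≡⟨ ^-*-assoc (suc y) m d ⟩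
    suc y ^ (m * d)   ≤⟨ ^-monoʳ-≤ (suc y) (<⇒≤ (ℤ.drop‿+<+ (subst₂ ℤ._<_ (sym (ℤ.pos-* m d)) (sym (ℤ.pos-* a e)) me<ad))) ⟩
    suc y ^ (a * e)   ≡⟨ ^-*-assoc (suc y) a e ⟨
    (suc y ^ a) ^ e   ≤⟨ ^-monoˡ-≤ e y^a≤x^d ⟩
    (x ^ d) ^ e       ≡⟨ ^-*-assoc x d e ⟩
    x ^ (d * e)       ≡⟨ cong (x ^_) (*-comm d e) ⟩
    x ^ (e * d)       ≡⟨ ^-*-assoc x e d ⟨
    (x ^ e) ^ d       ∎)
    where e = suc e-1
  RatPow≤-< y zero    (mkℚ -[1+ m ] e-1 c) y^a≤0 _ =
    ⊥-elim (<⇒≱ (m^n>0 (suc y) a) y^a≤0)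
  RatPow≤-< y (suc x) (mkℚ -[1+ m ] e-1 c) _     _ =
    *-mono-≤ (m^n>0 (suc x) (suc e-1)) (m^n>0 (suc y) (suc m))

  Pow≤-sup : ∀ y x → y ^ a ≤ x ^ d → Pow≤ y (fromℚ s) x
  Pow≤-sup zero    x _       = inj₁ 0<s
  Pow≤-sup (suc y) x y^a≤x^d = λ r → RatPow≤-< y x r y^a≤x^d

  -- The values y ≥ k ^ d and x ≤ C k ^ a, with k arbitrarily large, exclude exponents above a / d.
  RatPow≤-> : ∀ C r → s ℚ.< r →
    (∀ k → .{{NonZero k}} → ∃[ y ] ∃[ x ] (k ^ d ≤ y × x ≤ C * k ^ a × RatPow≤ y r x)) → ⊥
  RatPow≤-> C (mkℚ -[1+ m ] e-1 c) s<r _ with () ← ℚ.<-asym (ℚ.<-trans 0<s s<r) (ℚ.negative⁻¹ (mkℚ -[1+ m ] e-1 c))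
  RatPow≤-> C (mkℚ (+ m) e-1 c) s<r family
    with *<* ae<md ← ℚᵘ.<-respˡ-≃ (ℚ.toℚᵘ-fromℚᵘ (mkℚᵘ (+ a) b)) (ℚ.toℚᵘ-mono-< s<r)
       | y , x , k^d≤y , x≤Ck^a , y^m≤x^e ← family (suc (C ^ suc e-1)) =
    n≮n (C ^ e) (*-cancelʳ-≤ k (C ^ e) (k ^ (a * e)) {{m^n≢0 k (a * e)}} (begin
      k * k ^ (a * e)        ≤⟨ ^-monoʳ-≤ k (ℤ.drop‿+<+ (subst₂ ℤ._<_ (sym (ℤ.pos-* a e)) (sym (ℤ.pos-* m d)) ae<md)) ⟩
      k ^ (m * d)            ≡⟨ cong (k ^_) (*-comm m d) ⟩
      k ^ (d * m)            ≡⟨ ^-*-assoc k d m ⟨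
      (k ^ d) ^ m            ≤⟨ ^-monoˡ-≤ m k^d≤y ⟩
      y ^ m                  ≤⟨ y^m≤x^e ⟩
      x ^ e                  ≤⟨ ^-monoˡ-≤ e x≤Ck^a ⟩
      (C * k ^ a) ^ e        ≡⟨ ^-distribʳ-* e C (k ^ a) ⟩
      C ^ e * (k ^ a) ^ e    ≡⟨ cong (C ^ e *_) (^-*-assoc k a e) ⟩
      C ^ e * k ^ (a * e)    ∎))
    where
    e = suc e-1
    -- `m * d` exceeds `a * e` by at least one, which leaves a surplus factor `k`; it has to beat
    -- `C ^ e`.
    k = suc (C ^ e)

  -- The supremum is attained: domination makes `fromℚ s` itself an admissible exponent, so
  -- leastness is immediate.
  isHDE : ∀ F G C → 1 ≤ hom F G →
    (∀ H → hom G H ^ a ≤ hom F H ^ d) →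
    (∀ k → .{{NonZero k}} → ∃[ H ] (k ^ d ≤ hom G H × hom F H ≤ C * k ^ a)) →
    IsHDE F G (fromℚ s)
  isHDE F G C F→G dominates extremal = record
    { defined = F→G
    ; isSup   = bound , λ u bound-u → bound-u (fromℚ s) (λ H → Pow≤-sup (hom G H) (hom F H) (dominates H))
    }
    where
    bound : ∀ c → DominationExponent F G c → c ≤ᴿ fromℚ s
    bound c dom q q∈c with q ℚ.<? s
    ... | yes q<s = q<s
    -- Openness of the lower cut gives an exponent strictly above `s` even when `q` equals `s`.
    ... | no  q≮s with r , q<r , r∈c ← L-open c q∈c =
      ⊥-elim (RatPow≤-> C r (ℚ.≤-<-trans (ℚ.≮⇒≥ q≮s) q<r) λ k →
        let H , k^d≤y , x≤Ck^a = extremal k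
        in hom G H , hom F H , k^d≤y , x≤Ck^a ,
           positive (hom G H) (≤-trans (m^n>0 k d) k^d≤y) (dom H) r r∈c)
      where
      positive : ∀ y {x} → 1 ≤ y → Pow≤ y c x → ∀ r → L c r → RatPow≤ y r x
      positive (suc y) _ pow = pow

theorem3p4 : ∀ (n : ℕ) → 1 ≤ n →
    IsHDE (P 4) (P (4 * n + 2)) (fromℚ (+ (4 * n + 1) / (1 + 3 * n + 4 * n ^ 2)))
-- `1 + 3 * n + 4 * n ^ 2` computes to the successor of the second argument, as the denominator in
-- `isHDE` requires.
theorem3p4 n@(suc m) _ = isHDE (4 * n + 1) (3 * n + 4 * n ^ 2) {{>-nonZero (m≤n+m 1 (4 * n))}}
  (P 4) (P (4 * n + 2)) ((suc n + n) * 8)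
  (P-mono (≤-trans (m≤m*n 4 n) (m≤m+n (4 * n) 2)))
  dominates extremal
  where
  hom-P : ∀ H → hom (P (4 * n + 2)) H ≡ hom (P (suc (4 * n + 1))) H
  hom-P H = cong (λ l → hom (P l) H) (+-suc (4 * n) 1)

  dominates : ∀ H → hom (P (4 * n + 2)) H ^ (4 * n + 1) ≤ hom (P 4) H ^ (1 + 3 * n + 4 * n ^ 2)
  dominates H = subst₂ (λ y x → y ^ (4 * n + 1) ≤ x ^ (1 + 3 * n + 4 * n ^ 2))
    (sym (trans (hom-P H) (hom-path H (4 * n + 1)))) (sym (hom-path H 3))
    (walks-dominated (allFin (∣V∣ H)) (bidirected H) (bidirected-sym H) m)

  extremal : ∀ k → .{{NonZero k}} → ∃[ H ]
    (k ^ (1 + 3 * n + 4 * n ^ 2) ≤ hom (P (4 * n + 2)) H × hom (P 4) H ≤ (suc n + n) * 8 * k ^ (4 * n + 1))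
  extremal k@(suc _) = H ,
    subst (k ^ (1 + 3 * n + 4 * n ^ 2) ≤_)
      (sym (trans (hom-P H) (hom-listGraph vertices adj adj-sym (4 * n + 1)))) (walks-≥ m refl) ,
    subst (_≤ (suc n + n) * 8 * k ^ (4 * n + 1))
      (sym (hom-listGraph vertices adj adj-sym 3)) walks3-≤
    where
    open Extremal n k
    H = listGraph vertices adj
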